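{- Let $N\ge 16$ be an integer, and write $N=3k+i$ with $k\in\mathbb{N}$ and $i\in\{0,1,2\}$. Let $P^N_*$ denote the maximal number of finite paths $|FP(E)|$ over all connected acyclic directed graphs $E$ with exactly $N$ edges. Then $$P^N_*=\begin{cases}\frac14\left(121\cdot 3^{k-2}-2k+7\right) & \text{if } i=0,\\[2pt] \frac14\left(529\cdot 3^{k-3}-2k+25\right) & \text{if } i=1,\\[2pt] \frac14\left(253\cdot 3^{k-2}-2k+15\right) & \text{if } i=2.\end{cases}$$
   Context: A directed graph $E=(E^0,E^1,s_E,t_E)$ consists of a set of vertices $E^0$, a set of edges $E^1$, and source and target maps $s_E,t_E\colon E^1\to E^0$ (multiple edges are allowed). A finite path of length $n\ge1$ is a tuple $(e_1,\dots,e_n)$ of edges with $t_E(e_i)=s_E(e_{i+1})$ for $1\le i<n$; vertices are paths of length $0$. $FP(E)$ is the set of all finite paths in $E$ (including those of length $0$). $E$ is acyclic if it has no path of positive length whose beginning and end coincide. $E$ is connected if any two vertices are joined by a finite undirected path. -}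

module Defs where

open import Data.Fin using (Fin; zero; suc)
open import Data.Integer as ℤ using (+_)
open import Data.Nat as ℕ using (ℕ; _≤_; _∸_; _^_)
open import Data.Product using (Σ-syntax; _×_)
open import Data.Rational as ℚ using (ℚ)
open import Function.Bundles using (_↔_)
open import Relation.Binary.Construct.Closure.Equivalence using (EqClosure)
open import Relation.Binary.Construct.Closure.ReflexiveTransitive using (Star)
open import Relation.Binary.Construct.Closure.Transitive using (TransClosure)
open import Relation.Binary.PropositionalEquality using (_≡_)
open import Relation.Nullary using (¬_)

record Graph : Set₁ where
  field
    Vertex : Set
    Edge   : Set
    source : Edge → Vertex
    target : Edge → Vertex

  -- The type of all edges from u to v; parallel edges are distinct elements.
  _⟶_ : Vertex → Vertex → Set
  u ⟶ v = Σ[ e ∈ Edge ] (source e ≡ u × target e ≡ v)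

  -- Star is proof-relevant: its elements are the paths themselves, with ε at
  -- v being the path of length 0 given by the vertex v.
  FP : Set
  FP = Σ[ u ∈ Vertex ] Σ[ v ∈ Vertex ] Star _⟶_ u v

  -- TransClosure consists of the paths of positive length.
  Acyclic : Set
  Acyclic = ∀ v → ¬ TransClosure _⟶_ v v

  Connected : Set
  Connected = ∀ u v → EqClosure _⟶_ u v

HasCardinality : Set → ℕ → Set
HasCardinality A n = A ↔ Fin n

PathNumber : ℕ → ℕ → Set₁
PathNumber N m = Σ[ E ∈ Graph ]
  ( HasCardinality (Graph.Edge E) N
  × Graph.Connected E
  × Graph.Acyclic E
  × HasCardinality (Graph.FP E) m )

IsMaximum : (ℕ → Set₁) → ℕ → Set₁
IsMaximum S P = S P × (∀ m → S m → m ≤ P)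

-- The exponents are only meant for k ≥ 3, where ∸ is ordinary subtraction;
-- the outer subtraction is in ℤ and the division in ℚ, hence both exact.
maxPathsFormula : ℕ → Fin 3 → ℚ
maxPathsFormula k zero             = (+ (121 ℕ.* 3 ^ (k ∸ 2)) ℤ.- + (2 ℕ.* k) ℤ.+ + 7) ℚ./ 4
maxPathsFormula k (suc zero)       = (+ (529 ℕ.* 3 ^ (k ∸ 3)) ℤ.- + (2 ℕ.* k) ℤ.+ + 25) ℚ./ 4
maxPathsFormula k (suc (suc zero)) = (+ (253 ℕ.* 3 ^ (k ∸ 2)) ℤ.- + (2 ℕ.* k) ℤ.+ + 15) ℚ./ 4

{-# OPTIONS --safe #-}
module Submission where

-- Why the theorem holds.  The extremal graphs are linear multigraphs: vertices v₀, v₁, ..., and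
-- d₁ parallel edges from v₀ to v₁, d₂ from v₁ to v₂, and so on.  Such a graph is described by the
-- composition (d₁, d₂, ...) of its number of edges, and only parts 1, 2, 3 matter, because an
-- edge bundle of size d ≥ 4 is inferior to two bundles of sizes 2 and d - 2.  The optimal
-- compositions are 1,2,3,...,3,2,1 with, depending on the residue of N modulo 3, no, one or two
-- further parts 2 next to the ends (optimal₀, optimal₂, optimal₁).
--
-- Every graph is dominated by a linear one (bounded-by-composition).  Number the vertices
-- injectively so that every edge leads to a smaller number, and treat the vertices that have
-- outgoing edges in increasing order.  Each of them has 1 + Σ f(target e) paths leaving it,
-- where f counts the paths leaving a vertex, the trivial one included.  Fix a sink s₀ which is the
-- target of an edge leaving the first such vertex.  An edge into any other sink contributes only 1
-- to the sum, so a vertex with r edges of this kind and t other edges has at most 1 + r + t R paths leaving it,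
-- when R bounds f on all the earlier vertices; prepending to the composition built so far the
-- parts 1,...,1 (r times) and then t yields at least as many.  The r new vertices obtained in
-- this way pay for the trivial paths at the sinks: connectedness supplies an edge into each of
-- them, and only s₀ has to be counted apart (absorb, process-suc).
--
-- It remains to maximise over compositions.  If x paths end at the first vertex of a linear graph
-- and y paths begin at its last one, then the number of paths meeting the graph, meeting x y c, is
-- computed by peeling off the first part d: x turns into 1 + d x, and x is added.  For x ≥ 9 and
-- y ≥ 5 the value of meeting x y c is bounded by one of an explicit list of expressions, which,
-- except when only one edge is left, are the values of the compositions consisting of 3s and at
-- most two parts 2 at the ends; that these bounds persist under peeling amounts to finitely many
-- polynomial inequalities (meeting≤).
-- Starting from x = y = 1 and peeling off parts from the left until x ≥ 9, and then from the right
-- until y ≥ 5, leaves finitely many cases for each residue of N modulo 3, all of them uniform in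
-- N ≥ 16; they are verified by evaluation (check-sound).
--
-- Conversely, every composition is realised by a connected acyclic graph, built by repeatedly
-- adding a new source joined to the old one by d parallel edges (realise).

open import Defs
open import Data.Bool using (Bool; true; false; T; if_then_else_; _∧_)
open import Data.Bool.ListAction using (all)
open import Data.Bool.Properties using (T-∧)
open import Data.Fin as Fin using (Fin; toℕ; zero; suc)
open import Data.Fin.Properties using (injective⇒≤; toℕ<n; toℕ-injective; +↔⊎; *↔×; 1↔⊤)
open import Data.List using (List; []; _∷_; length; filter; map; _++_; tabulate; lookup)
open import Data.List.Extrema.Nat using (max; argmin; xs≤max; max<v⁺; f[argmin]≤f[xs])
open import Data.List.Membership.Propositional using (_∈_; lose)
open import Data.List.Membership.Propositional.Properties
  using (∈-filter⁺; ∈-++⁺ˡ; ∈-++⁺ʳ; ∈-map⁺; ∈-tabulate⁺)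
open import Data.List.Properties using (length-++; length-map; length-tabulate; filter-none; filter-all)
open import Data.List.Relation.Unary.All as All using (All; []; _∷_)
open import Data.List.Relation.Unary.All.Properties using (all⁺; map⁺; all-filter)
open import Data.List.Relation.Unary.Any as Any using (Any; here; there)
open import Data.List.Relation.Unary.Any.Properties using (lookup-index)
open import Data.Maybe using (Maybe; just; nothing; maybe)
open import Data.Nat using (ℕ; suc; zero; _+_; _*_; _^_; _≤_; _<_; _≤ᵇ_; z≤n; s≤s)
open import Data.Nat.Properties
open import Data.Nat.Tactic.RingSolver using (solve-∀)
open import Data.Product using (Σ-syntax; ∃; ∃₂; ∃-syntax; _×_; _,_; proj₁; proj₂)
open import Data.Product.Function.NonDependent.Propositional using (_×-↔_)
open import Data.Sum using (_⊎_; inj₁; inj₂; [_,_]′)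
open import Data.Sum.Function.Propositional using (_⊎-↔_)
open import Data.Unit using (⊤; tt)
open import Function.Bundles using (_↔_; Inverse; Equivalence; mk↔ₛ′)
open import Function.Properties.Inverse using (↔-refl; ↔-sym; ↔-trans)
open import Relation.Binary using (tri<; tri≈; tri>)
import Relation.Binary.Construct.Closure.Equivalence as EqClosure
import Relation.Binary.Construct.Closure.ReflexiveTransitive as Star
open import Relation.Binary.Construct.Closure.ReflexiveTransitive using (Star; ε; _◅_; _◅◅_)
open import Relation.Binary.Construct.Closure.Symmetric using (fwd; bwd)
open import Relation.Binary.Construct.Closure.Transitive using (TransClosure; [_]; _∷_)
open import Relation.Binary.PropositionalEquality
  using (_≡_; _≢_; refl; sym; trans; cong; cong₂; subst; subst₂; module ≡-Reasoning)
open import Relation.Nullary using (Dec; yes; no; ¬_; contradiction; does; ¬?; _×-dec_; _⊎-dec_)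
open import Relation.Nullary.Decidable using (map′; dec-true)
open import Relation.Unary using (Decidable)

-- Compositions and the linear multigraphs they describe

-- A composition of n with parts in {1, 2, 3}, read as a linear multigraph with n edges: the first
-- part is the number of parallel edges leaving its unique source.
data Composition : ℕ → Set where
  []  : Composition 0
  1∷_ : ∀ {n} → Composition n → Composition (1 + n)
  2∷_ : ∀ {n} → Composition n → Composition (2 + n)
  3∷_ : ∀ {n} → Composition n → Composition (3 + n)

infixr 5 1∷_ 2∷_ 3∷_

-- The number of paths that begin at the source of the linear multigraph.
rooted : ∀ {n} → Composition n → ℕ
rooted []     = 1
rooted (1∷ c) = 1 + 1 * rooted c
rooted (2∷ c) = 1 + 2 * rooted c
rooted (3∷ c) = 1 + 3 * rooted c

-- The number of all paths of the linear multigraph.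
total : ∀ {n} → Composition n → ℕ
total []        = 1
total c₀@(1∷ c) = total c + rooted c₀
total c₀@(2∷ c) = total c + rooted c₀
total c₀@(3∷ c) = total c + rooted c₀

-- Let x paths end at the first vertex of the linear multigraph of c, and y paths begin at its last
-- vertex, the trivial path being counted in both cases; meeting x y c is the number of paths of the
-- whole graph that contain a vertex of c.  Peeling off the first part d leaves the x paths that
-- stop at the first vertex, and those that meet the rest, at whose first vertex 1 + d x paths end.
meeting : ∀ {n} → ℕ → ℕ → Composition n → ℕ
meeting x y []     = x * y
meeting x y (1∷ c) = x + meeting (1 + 1 * x) y c
meeting x y (2∷ c) = x + meeting (1 + 2 * x) y c
meeting x y (3∷ c) = x + meeting (1 + 3 * x) y c

-- Each of z nontrivial paths into the source can be continued by every path that leaves it.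
meeting-total : ∀ {n} z (c : Composition n) →
  meeting (1 + z) 1 c ≡ total c + z * rooted c
meeting-total z []     = base z
  where
  base : ∀ z → (1 + z) * 1 ≡ 1 + z * 1
  base = solve-∀
meeting-total z (1∷ c) = trans (cong (1 + z +_) (meeting-total _ c)) (step z (total c) (rooted c))
  where
  step : ∀ z t r → 1 + z + (t + (1 * (1 + z)) * r) ≡ t + (1 + 1 * r) + z * (1 + 1 * r)
  step = solve-∀
meeting-total z (2∷ c) = trans (cong (1 + z +_) (meeting-total _ c)) (step z (total c) (rooted c))
  where
  step : ∀ z t r → 1 + z + (t + (2 * (1 + z)) * r) ≡ t + (1 + 2 * r) + z * (1 + 2 * r)
  step = solve-∀
meeting-total z (3∷ c) = trans (cong (1 + z +_) (meeting-total _ c)) (step z (total c) (rooted c))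
  where
  step : ∀ z t r → 1 + z + (t + (3 * (1 + z)) * r) ≡ t + (1 + 3 * r) + z * (1 + 3 * r)
  step = solve-∀

total≡meeting : ∀ {n} (c : Composition n) → total c ≡ meeting 1 1 c
total≡meeting c = sym (trans (meeting-total 0 c) (+-identityʳ (total c)))

infixl 5 _∷ʳ1 _∷ʳ2 _∷ʳ3

-- Appending a part at the sink end.
_∷ʳ1 : ∀ {n} → Composition n → Composition (1 + n)
[]     ∷ʳ1 = 1∷ []
(1∷ c) ∷ʳ1 = 1∷ (c ∷ʳ1)
(2∷ c) ∷ʳ1 = 2∷ (c ∷ʳ1)
(3∷ c) ∷ʳ1 = 3∷ (c ∷ʳ1)

_∷ʳ2 : ∀ {n} → Composition n → Composition (2 + n)
[]     ∷ʳ2 = 2∷ []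
(1∷ c) ∷ʳ2 = 1∷ (c ∷ʳ2)
(2∷ c) ∷ʳ2 = 2∷ (c ∷ʳ2)
(3∷ c) ∷ʳ2 = 3∷ (c ∷ʳ2)

_∷ʳ3 : ∀ {n} → Composition n → Composition (3 + n)
[]     ∷ʳ3 = 3∷ []
(1∷ c) ∷ʳ3 = 1∷ (c ∷ʳ3)
(2∷ c) ∷ʳ3 = 2∷ (c ∷ʳ3)
(3∷ c) ∷ʳ3 = 3∷ (c ∷ʳ3)

private
  +-swap : ∀ x y m → x + (y + m) ≡ y + (x + m)
  +-swap = solve-∀

meeting-∷ʳ1 : ∀ {n} x y (c : Composition n) → meeting x y (c ∷ʳ1) ≡ y + meeting x (1 + 1 * y) c
meeting-∷ʳ1 x y []     = base x y
  where
  base : ∀ x y → x + (1 + 1 * x) * y ≡ y + x * (1 + 1 * y)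
  base = solve-∀
meeting-∷ʳ1 x y (1∷ c) = trans (cong (x +_) (meeting-∷ʳ1 _ y c)) (+-swap x y _)
meeting-∷ʳ1 x y (2∷ c) = trans (cong (x +_) (meeting-∷ʳ1 _ y c)) (+-swap x y _)
meeting-∷ʳ1 x y (3∷ c) = trans (cong (x +_) (meeting-∷ʳ1 _ y c)) (+-swap x y _)

meeting-∷ʳ2 : ∀ {n} x y (c : Composition n) → meeting x y (c ∷ʳ2) ≡ y + meeting x (1 + 2 * y) c
meeting-∷ʳ2 x y []     = base x y
  where
  base : ∀ x y → x + (1 + 2 * x) * y ≡ y + x * (1 + 2 * y)
  base = solve-∀
meeting-∷ʳ2 x y (1∷ c) = trans (cong (x +_) (meeting-∷ʳ2 _ y c)) (+-swap x y _)
meeting-∷ʳ2 x y (2∷ c) = trans (cong (x +_) (meeting-∷ʳ2 _ y c)) (+-swap x y _)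
meeting-∷ʳ2 x y (3∷ c) = trans (cong (x +_) (meeting-∷ʳ2 _ y c)) (+-swap x y _)

meeting-∷ʳ3 : ∀ {n} x y (c : Composition n) → meeting x y (c ∷ʳ3) ≡ y + meeting x (1 + 3 * y) c
meeting-∷ʳ3 x y []     = base x y
  where
  base : ∀ x y → x + (1 + 3 * x) * y ≡ y + x * (1 + 3 * y)
  base = solve-∀
meeting-∷ʳ3 x y (1∷ c) = trans (cong (x +_) (meeting-∷ʳ3 _ y c)) (+-swap x y _)
meeting-∷ʳ3 x y (2∷ c) = trans (cong (x +_) (meeting-∷ʳ3 _ y c)) (+-swap x y _)
meeting-∷ʳ3 x y (3∷ c) = trans (cong (x +_) (meeting-∷ʳ3 _ y c)) (+-swap x y _)

reverse : ∀ {n} → Composition n → Composition n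
reverse []     = []
reverse (1∷ c) = reverse c ∷ʳ1
reverse (2∷ c) = reverse c ∷ʳ2
reverse (3∷ c) = reverse c ∷ʳ3

meeting-reverse : ∀ {n} x y (c : Composition n) → meeting y x (reverse c) ≡ meeting x y c
meeting-reverse x y []     = *-comm y x
meeting-reverse x y (1∷ c) = trans (meeting-∷ʳ1 y x (reverse c)) (cong (x +_) (meeting-reverse _ y c))
meeting-reverse x y (2∷ c) = trans (meeting-∷ʳ2 y x (reverse c)) (cong (x +_) (meeting-reverse _ y c))
meeting-reverse x y (3∷ c) = trans (meeting-∷ʳ3 y x (reverse c)) (cong (x +_) (meeting-reverse _ y c))

-- Bounds for compositions between two large ends

-- A bound for h = meeting x y c, where c is a composition of r + 3 k with r < 3, of the shape
-- 12 h + 6 k + loss ≤ q slope + gain with q = 3 ^ k.  Subtracted terms are collected in the loss.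
-- The factor 4 clears the denominators of the sums over powers of 3; the remaining factor 3 is
-- there for the residue r = 1, whose leading power of 3 is 3 ^ (k - 1).
record Bound : Set where
  constructor bound
  field
    slope loss gain : ℕ

open Bound

Holds : ℕ → ℕ → ℕ → Bound → Set
Holds q k h b = 12 * h + (6 * k + loss b) ≤ q * slope b + gain b

-- In terms of 1 + 2 x, prefixing a part 3 is multiplication by 3.
odd : ℕ → ℕ
odd x = 1 + 2 * x

-- The index is the residue r.  The bound B₀ is the value of the composition 3,...,3; B₂ˡ and B₂ʳ
-- are the values for a part 2 at the left or right end of 3,...,3; B₁ˡʳ, B₁ˡˡ, B₁ʳʳ are those for
-- two parts 2, distributed over the ends as indicated, and belong to k ≥ 1.  The value of the
-- composition with the single part 1 is B₁, with k = 0.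
B₀ B₁ B₁ˡʳ B₁ˡˡ B₁ʳʳ B₂ˡ B₂ʳ : ℕ → ℕ → Bound
B₀   x y = bound (3 * (odd x * odd y)) (3 * (odd x + odd y)) 3
B₁   x y = bound (3 * (odd x * odd y + (odd x + odd y))) 9 0
B₁ˡʳ x y = bound ((2 * odd x + 1) * (2 * odd y + 1)) 9 0
B₁ˡˡ x y = bound ((4 * odd x + 3) * odd y) (3 * (odd y + 2)) (6 * odd x)
B₁ʳʳ x y = bound (odd x * (4 * odd y + 3)) (3 * (odd x + 2)) (6 * odd y)
B₂ˡ  x y = bound (3 * ((2 * odd x + 1) * odd y)) (3 * (odd y + 2)) 0
B₂ʳ  x y = bound (3 * (odd x * (2 * odd y + 1))) (3 * (odd x + 2)) 0

-- The range of x, y and q = 3 ^ k in which the bounds are compared, with the excesses a, b, p.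
data Large : ℕ → ℕ → ℕ → Set where
  large : ∀ a b p → Large (9 + a) (5 + b) (1 + p)

-- The part of Large where x ≤ y.
data LargeLE : ℕ → ℕ → ℕ → Set where
  largeLE : ∀ a b p → LargeLE (9 + a) (9 + a + b) (1 + p)

-- A range that contains the part of Large where y ≤ x.
data LargeGE : ℕ → ℕ → ℕ → Set where
  largeGE : ∀ a b p → LargeGE (5 + a + b) (5 + b) (1 + p)

-- One step of peeling: a bound r′ for the rest of the composition, of value h, gives a bound r for the
-- whole, of value x + h, if the latter has some slack s ≥ 0 to spare.
improve : ∀ x h {m m′ r r′ s} → r′ + (12 * x + m) + s ≡ r + m′ →
          12 * h + m′ ≤ r′ → 12 * (x + h) + m ≤ r
improve x h {m} {m′} {r} {r′} {s} eq hyp = +-cancelʳ-≤ m′ _ _ (begin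
  12 * (x + h) + m + m′          ≡⟨ lemma x h m m′ ⟩
  12 * h + m′ + (12 * x + m)     ≤⟨ +-monoˡ-≤ (12 * x + m) hyp ⟩
  r′ + (12 * x + m)              ≤⟨ m≤m+n _ s ⟩
  r′ + (12 * x + m) + s          ≡⟨ eq ⟩
  r + m′                         ∎)
  where
  open ≤-Reasoning
  lemma : ∀ x h m m′ → 12 * (x + h) + m + m′ ≡ 12 * h + m′ + (12 * x + m)
  lemma = solve-∀

-- In B⇐d∷B′ the bound B for a composition with first part d is derived from the bound B′ for the
-- rest.  The slack is a polynomial in the excesses a, b, p with nonnegative coefficients, displayed
-- as the last summand of the left hand side of eq.  A suffix -≤ or -≥ marks an implication that
-- needs x ≤ y or y ≤ x.
B₀⇐3∷B₀ : ∀ {x y q h} k → Large x y q →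
  Holds q k h (B₀ (1 + 3 * x) y) → Holds (3 * q) (1 + k) (x + h) (B₀ x y)
B₀⇐3∷B₀ {h = h} k (large a b p) = improve (9 + a) h (eq a b p k)
  where
  eq : ∀ a b p k →
    let x = 9 + a; X = 1 + 2 * x; X′ = 1 + 2 * (1 + 3 * x); Y = 1 + 2 * (5 + b) in
    (1 + p) * (3 * (X′ * Y)) + 3 + (12 * x + (6 * (1 + k) + 3 * (X + Y))) +
    0
    ≡ (3 * (1 + p)) * (3 * (X * Y)) + 3 + (6 * k + 3 * (X′ + Y))
  eq = solve-∀

B₀⇐2∷B₁ˡʳ : ∀ {x y q h} k → Large x y q →
  Holds (3 * q) k h (B₁ˡʳ (1 + 2 * x) y) → Holds (3 * (3 * q)) (1 + k) (x + h) (B₀ x y)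
B₀⇐2∷B₁ˡʳ {h = h} k (large a b p) = improve (9 + a) h (eq a b p k)
  where
  eq : ∀ a b p k →
    let x = 9 + a; X = 1 + 2 * x; X′ = 1 + 2 * (1 + 2 * x); Y = 1 + 2 * (5 + b) in
    (3 * (1 + p)) * ((2 * X′ + 1) * (2 * Y + 1)) + 0 + (12 * x + (6 * (1 + k) + 3 * (X + Y))) +
    (12 * a * b * p + 12 * a * b + 42 * a * p + 24 * a + 78 * b * p + 72 * b + 192 * p)
    ≡ (3 * (3 * (1 + p))) * (3 * (X * Y)) + 3 + (6 * k + 9)
  eq = solve-∀

B₀⇐2∷B₁ˡˡ : ∀ {x y q h} k → Large x y q →
  Holds (3 * q) k h (B₁ˡˡ (1 + 2 * x) y) → Holds (3 * (3 * q)) (1 + k) (x + h) (B₀ x y)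
B₀⇐2∷B₁ˡˡ {h = h} k (large a b p) = improve (9 + a) h (eq a b p k)
  where
  eq : ∀ a b p k →
    let x = 9 + a; X = 1 + 2 * x; X′ = 1 + 2 * (1 + 2 * x); Y = 1 + 2 * (5 + b) in
    (3 * (1 + p)) * ((4 * X′ + 3) * Y) + 6 * X′ + (12 * x + (6 * (1 + k) + 3 * (X + Y))) +
    (12 * a * b * p + 12 * a * b + 66 * a * p + 24 * a + 72 * b * p + 72 * b + 396 * p)
    ≡ (3 * (3 * (1 + p))) * (3 * (X * Y)) + 3 + (6 * k + 3 * (Y + 2))
  eq = solve-∀

B₀⇐2∷B₁ʳʳ : ∀ {x y q h} k → Large x y q →
  Holds (3 * q) k h (B₁ʳʳ (1 + 2 * x) y) → Holds (3 * (3 * q)) (1 + k) (x + h) (B₀ x y)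
B₀⇐2∷B₁ʳʳ {h = h} k (large a b p) = improve (9 + a) h (eq a b p k)
  where
  eq : ∀ a b p k →
    let x = 9 + a; X = 1 + 2 * x; X′ = 1 + 2 * (1 + 2 * x); Y = 1 + 2 * (5 + b) in
    (3 * (1 + p)) * (X′ * (4 * Y + 3)) + 6 * Y + (12 * x + (6 * (1 + k) + 3 * (X + Y))) +
    (12 * a * b * p + 12 * a * b + 30 * a * p + 24 * a + 90 * b * p + 72 * b + 144 * p)
    ≡ (3 * (3 * (1 + p))) * (3 * (X * Y)) + 3 + (6 * k + 3 * (X′ + 2))
  eq = solve-∀

B₀⇐1∷B₂ˡ : ∀ {x y q h} k → Large x y q →
  Holds q k h (B₂ˡ (1 + 1 * x) y) → Holds (3 * q) (1 + k) (x + h) (B₀ x y)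
B₀⇐1∷B₂ˡ {h = h} k (large a b p) = improve (9 + a) h (eq a b p k)
  where
  eq : ∀ a b p k →
    let x = 9 + a; X = 1 + 2 * x; X′ = 1 + 2 * (1 + 1 * x); Y = 1 + 2 * (5 + b) in
    (1 + p) * (3 * ((2 * X′ + 1) * Y)) + 0 + (12 * x + (6 * (1 + k) + 3 * (X + Y))) +
    (12 * a * b * p + 12 * a * b + 66 * a * p + 48 * a + 84 * b * p + 84 * b + 462 * p + 300)
    ≡ (3 * (1 + p)) * (3 * (X * Y)) + 3 + (6 * k + 3 * (Y + 2))
  eq = solve-∀

B₀⇐1∷B₂ʳ : ∀ {x y q h} k → Large x y q →
  Holds q k h (B₂ʳ (1 + 1 * x) y) → Holds (3 * q) (1 + k) (x + h) (B₀ x y)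
B₀⇐1∷B₂ʳ {h = h} k (large a b p) = improve (9 + a) h (eq a b p k)
  where
  eq : ∀ a b p k →
    let x = 9 + a; X = 1 + 2 * x; X′ = 1 + 2 * (1 + 1 * x); Y = 1 + 2 * (5 + b) in
    (1 + p) * (3 * (X′ * (2 * Y + 1))) + 0 + (12 * x + (6 * (1 + k) + 3 * (X + Y))) +
    (12 * a * b * p + 12 * a * b + 60 * a * p + 48 * a + 90 * b * p + 84 * b + 432 * p + 300)
    ≡ (3 * (1 + p)) * (3 * (X * Y)) + 3 + (6 * k + 3 * (X′ + 2))
  eq = solve-∀

B₀⇐2∷B₁ : ∀ {x y h} → Large x y 1 →
  Holds 1 0 h (B₁ (1 + 2 * x) y) → Holds (3 * 1) 1 (x + h) (B₀ x y)
B₀⇐2∷B₁ {h = h} (large a b _) = improve (9 + a) h (eq a b)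
  where
  eq : ∀ a b →
    let x = 9 + a; X = 1 + 2 * x; X′ = 1 + 2 * (1 + 2 * x); Y = 1 + 2 * (5 + b) in
    1 * (3 * (X′ * Y + (X′ + Y))) + 0 + (12 * x + (6 * 1 + 3 * (X + Y))) +
    (12 * a * b + 36 * a + 96 * b + 252)
    ≡ (3 * 1) * (3 * (X * Y)) + 3 + (6 * 0 + 9)
  eq = solve-∀

B₁ˡʳ⇐3∷B₁ˡʳ-≤ : ∀ {x y q h} k → LargeLE x y q →
  Holds (3 * q) k h (B₁ˡʳ (1 + 3 * x) y) → Holds (3 * (3 * q)) (1 + k) (x + h) (B₁ˡʳ x y)
B₁ˡʳ⇐3∷B₁ˡʳ-≤ {h = h} k (largeLE a b p) = improve (9 + a) h (eq a b p k)
  where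
  eq : ∀ a b p k →
    let x = 9 + a; X = 1 + 2 * x; X′ = 1 + 2 * (1 + 3 * x); Y = 1 + 2 * (9 + a + b) in
    (3 * (1 + p)) * ((2 * X′ + 1) * (2 * Y + 1)) + 0 + (12 * x + (6 * (1 + k) + 9)) +
    (24 * a * p + 12 * a + 24 * b * p + 24 * b + 234 * p + 120)
    ≡ (3 * (3 * (1 + p))) * ((2 * X + 1) * (2 * Y + 1)) + 0 + (6 * k + 9)
  eq = solve-∀

B₁ʳʳ⇐3∷B₁ˡʳ-≥ : ∀ {x y q h} k → LargeGE x y q →
  Holds (3 * q) k h (B₁ˡʳ (1 + 3 * x) y) → Holds (3 * (3 * q)) (1 + k) (x + h) (B₁ʳʳ x y)
B₁ʳʳ⇐3∷B₁ˡʳ-≥ {h = h} k (largeGE a b p) = improve (5 + a + b) h (eq a b p k)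
  where
  eq : ∀ a b p k →
    let x = 5 + a + b; X = 1 + 2 * x; X′ = 1 + 2 * (1 + 3 * x); Y = 1 + 2 * (5 + b) in
    (3 * (1 + p)) * ((2 * X′ + 1) * (2 * Y + 1)) + 0 + (12 * x + (6 * (1 + k) + 3 * (X + 2))) +
    (18 * a * p + 6 * b * p + 30 * p)
    ≡ (3 * (3 * (1 + p))) * (X * (4 * Y + 3)) + 6 * Y + (6 * k + 9)
  eq = solve-∀

B₁ˡˡ⇐3∷B₁ˡˡ-≤ : ∀ {x y q h} k → LargeLE x y q →
  Holds (3 * q) k h (B₁ˡˡ (1 + 3 * x) y) → Holds (3 * (3 * q)) (1 + k) (x + h) (B₁ˡˡ x y)
B₁ˡˡ⇐3∷B₁ˡˡ-≤ {h = h} k (largeLE a b p) = improve (9 + a) h (eq a b p k)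
  where
  eq : ∀ a b p k →
    let x = 9 + a; X = 1 + 2 * x; X′ = 1 + 2 * (1 + 3 * x); Y = 1 + 2 * (9 + a + b) in
    (3 * (1 + p)) * ((4 * X′ + 3) * Y) + 6 * X′ + (12 * x + (6 * (1 + k) + 3 * (Y + 2))) +
    (36 * a * p + 36 * b * p + 36 * b + 342 * p)
    ≡ (3 * (3 * (1 + p))) * ((4 * X + 3) * Y) + 6 * X + (6 * k + 3 * (Y + 2))
  eq = solve-∀

B₁ʳʳ⇐3∷B₁ˡˡ-≥ : ∀ {x y q h} k → LargeGE x y q →
  Holds (3 * q) k h (B₁ˡˡ (1 + 3 * x) y) → Holds (3 * (3 * q)) (1 + k) (x + h) (B₁ʳʳ x y)
B₁ʳʳ⇐3∷B₁ˡˡ-≥ {h = h} k (largeGE a b p) = improve (5 + a + b) h (eq a b p k)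
  where
  eq : ∀ a b p k →
    let x = 5 + a + b; X = 1 + 2 * x; X′ = 1 + 2 * (1 + 3 * x); Y = 1 + 2 * (5 + b) in
    (3 * (1 + p)) * ((4 * X′ + 3) * Y) + 6 * X′ + (12 * x + (6 * (1 + k) + 3 * (X + 2))) +
    (54 * a * p + 36 * b * p + 198 * p)
    ≡ (3 * (3 * (1 + p))) * (X * (4 * Y + 3)) + 6 * Y + (6 * k + 3 * (Y + 2))
  eq = solve-∀

B₁ʳʳ⇐3∷B₁ʳʳ : ∀ {x y q h} k → Large x y q →
  Holds (3 * q) k h (B₁ʳʳ (1 + 3 * x) y) → Holds (3 * (3 * q)) (1 + k) (x + h) (B₁ʳʳ x y)
B₁ʳʳ⇐3∷B₁ʳʳ {h = h} k (large a b p) = improve (9 + a) h (eq a b p k)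
  where
  eq : ∀ a b p k →
    let x = 9 + a; X = 1 + 2 * x; X′ = 1 + 2 * (1 + 3 * x); Y = 1 + 2 * (5 + b) in
    (3 * (1 + p)) * (X′ * (4 * Y + 3)) + 6 * Y + (12 * x + (6 * (1 + k) + 3 * (X + 2))) +
    0
    ≡ (3 * (3 * (1 + p))) * (X * (4 * Y + 3)) + 6 * Y + (6 * k + 3 * (X′ + 2))
  eq = solve-∀

B₁ˡʳ⇐3∷B₁ : ∀ {x y h} → Large x y 1 →
  Holds 1 0 h (B₁ (1 + 3 * x) y) → Holds (3 * 1) 1 (x + h) (B₁ˡʳ x y)
B₁ˡʳ⇐3∷B₁ {h = h} (large a b _) = improve (9 + a) h (eq a b)
  where
  eq : ∀ a b →
    let x = 9 + a; X = 1 + 2 * x; X′ = 1 + 2 * (1 + 3 * x); Y = 1 + 2 * (5 + b) in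
    1 * (3 * (X′ * Y + (X′ + Y))) + 0 + (12 * x + (6 * 1 + 9)) +
    (12 * a * b + 48 * a + 120 * b + 492)
    ≡ (3 * 1) * ((2 * X + 1) * (2 * Y + 1)) + 0 + (6 * 0 + 9)
  eq = solve-∀

B₁ˡˡ⇐2∷B₂ˡ : ∀ {x y q h} k → Large x y q →
  Holds q k h (B₂ˡ (1 + 2 * x) y) → Holds (3 * q) (1 + k) (x + h) (B₁ˡˡ x y)
B₁ˡˡ⇐2∷B₂ˡ {h = h} k (large a b p) = improve (9 + a) h (eq a b p k)
  where
  eq : ∀ a b p k →
    let x = 9 + a; X = 1 + 2 * x; X′ = 1 + 2 * (1 + 2 * x); Y = 1 + 2 * (5 + b) in
    (1 + p) * (3 * ((2 * X′ + 1) * Y)) + 0 + (12 * x + (6 * (1 + k) + 3 * (Y + 2))) +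
    0
    ≡ (3 * (1 + p)) * ((4 * X + 3) * Y) + 6 * X + (6 * k + 3 * (Y + 2))
  eq = solve-∀

B₁ˡʳ⇐2∷B₂ʳ : ∀ {x y q h} k → Large x y q →
  Holds q k h (B₂ʳ (1 + 2 * x) y) → Holds (3 * q) (1 + k) (x + h) (B₁ˡʳ x y)
B₁ˡʳ⇐2∷B₂ʳ {h = h} k (large a b p) = improve (9 + a) h (eq a b p k)
  where
  eq : ∀ a b p k →
    let x = 9 + a; X = 1 + 2 * x; X′ = 1 + 2 * (1 + 2 * x); Y = 1 + 2 * (5 + b) in
    (1 + p) * (3 * (X′ * (2 * Y + 1))) + 0 + (12 * x + (6 * (1 + k) + 9)) +
    0
    ≡ (3 * (1 + p)) * ((2 * X + 1) * (2 * Y + 1)) + 0 + (6 * k + 3 * (X′ + 2))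
  eq = solve-∀

B₁ˡʳ⇐1∷B₀ : ∀ {x y q h} k → Large x y q →
  Holds (3 * q) k h (B₀ (1 + 1 * x) y) → Holds (3 * q) k (x + h) (B₁ˡʳ x y)
B₁ˡʳ⇐1∷B₀ {h = h} k (large a b p) = improve (9 + a) h (eq a b p k)
  where
  eq : ∀ a b p k →
    let x = 9 + a; X = 1 + 2 * x; X′ = 1 + 2 * (1 + 1 * x); Y = 1 + 2 * (5 + b) in
    (3 * (1 + p)) * (3 * (X′ * Y)) + 3 + (12 * x + (6 * k + 9)) +
    (12 * a * b * p + 12 * a * b + 78 * a * p + 72 * a + 90 * b * p + 96 * b + 612 * p + 588)
    ≡ (3 * (1 + p)) * ((2 * X + 1) * (2 * Y + 1)) + 0 + (6 * k + 3 * (X′ + Y))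
  eq = solve-∀

B₂ˡ⇐3∷B₂ˡ-≤ : ∀ {x y q h} k → LargeLE x y q →
  Holds q k h (B₂ˡ (1 + 3 * x) y) → Holds (3 * q) (1 + k) (x + h) (B₂ˡ x y)
B₂ˡ⇐3∷B₂ˡ-≤ {h = h} k (largeLE a b p) = improve (9 + a) h (eq a b p k)
  where
  eq : ∀ a b p k →
    let x = 9 + a; X = 1 + 2 * x; X′ = 1 + 2 * (1 + 3 * x); Y = 1 + 2 * (9 + a + b) in
    (1 + p) * (3 * ((2 * X′ + 1) * Y)) + 0 + (12 * x + (6 * (1 + k) + 3 * (Y + 2))) +
    (12 * a * p + 12 * b * p + 12 * b + 114 * p)
    ≡ (3 * (1 + p)) * (3 * ((2 * X + 1) * Y)) + 0 + (6 * k + 3 * (Y + 2))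
  eq = solve-∀

B₂ʳ⇐3∷B₂ˡ-≥ : ∀ {x y q h} k → LargeGE x y q →
  Holds q k h (B₂ˡ (1 + 3 * x) y) → Holds (3 * q) (1 + k) (x + h) (B₂ʳ x y)
B₂ʳ⇐3∷B₂ˡ-≥ {h = h} k (largeGE a b p) = improve (5 + a + b) h (eq a b p k)
  where
  eq : ∀ a b p k →
    let x = 5 + a + b; X = 1 + 2 * x; X′ = 1 + 2 * (1 + 3 * x); Y = 1 + 2 * (5 + b) in
    (1 + p) * (3 * ((2 * X′ + 1) * Y)) + 0 + (12 * x + (6 * (1 + k) + 3 * (X + 2))) +
    (18 * a * p + 12 * b * p + 66 * p)
    ≡ (3 * (1 + p)) * (3 * (X * (2 * Y + 1))) + 0 + (6 * k + 3 * (Y + 2))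
  eq = solve-∀

B₂ʳ⇐3∷B₂ʳ : ∀ {x y q h} k → Large x y q →
  Holds q k h (B₂ʳ (1 + 3 * x) y) → Holds (3 * q) (1 + k) (x + h) (B₂ʳ x y)
B₂ʳ⇐3∷B₂ʳ {h = h} k (large a b p) = improve (9 + a) h (eq a b p k)
  where
  eq : ∀ a b p k →
    let x = 9 + a; X = 1 + 2 * x; X′ = 1 + 2 * (1 + 3 * x); Y = 1 + 2 * (5 + b) in
    (1 + p) * (3 * (X′ * (2 * Y + 1))) + 0 + (12 * x + (6 * (1 + k) + 3 * (X + 2))) +
    0
    ≡ (3 * (1 + p)) * (3 * (X * (2 * Y + 1))) + 0 + (6 * k + 3 * (X′ + 2))
  eq = solve-∀

B₂ˡ⇐2∷B₀ : ∀ {x y q h} k → Large x y q →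
  Holds q k h (B₀ (1 + 2 * x) y) → Holds q k (x + h) (B₂ˡ x y)
B₂ˡ⇐2∷B₀ {h = h} k (large a b p) = improve (9 + a) h (eq a b p k)
  where
  eq : ∀ a b p k →
    let x = 9 + a; X = 1 + 2 * x; X′ = 1 + 2 * (1 + 2 * x); Y = 1 + 2 * (5 + b) in
    (1 + p) * (3 * (X′ * Y)) + 3 + (12 * x + (6 * k + 3 * (Y + 2))) +
    0
    ≡ (1 + p) * (3 * ((2 * X + 1) * Y)) + 0 + (6 * k + 3 * (X′ + Y))
  eq = solve-∀

B₂ˡ⇐1∷B₁ˡʳ : ∀ {x y q h} k → Large x y q →
  Holds (3 * q) k h (B₁ˡʳ (1 + 1 * x) y) → Holds (3 * q) k (x + h) (B₂ˡ x y)
B₂ˡ⇐1∷B₁ˡʳ {h = h} k (large a b p) = improve (9 + a) h (eq a b p k)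
  where
  eq : ∀ a b p k →
    let x = 9 + a; X = 1 + 2 * x; X′ = 1 + 2 * (1 + 1 * x); Y = 1 + 2 * (5 + b) in
    (3 * (1 + p)) * ((2 * X′ + 1) * (2 * Y + 1)) + 0 + (12 * x + (6 * k + 3 * (Y + 2))) +
    (24 * a * b * p + 24 * a * b + 120 * a * p + 108 * a + 186 * b * p + 180 * b + 894 * p + 756)
    ≡ (3 * (1 + p)) * (3 * ((2 * X + 1) * Y)) + 0 + (6 * k + 9)
  eq = solve-∀

B₂ˡ⇐1∷B₁ˡˡ : ∀ {x y q h} k → Large x y q →
  Holds (3 * q) k h (B₁ˡˡ (1 + 1 * x) y) → Holds (3 * q) k (x + h) (B₂ˡ x y)
B₂ˡ⇐1∷B₁ˡˡ {h = h} k (large a b p) = improve (9 + a) h (eq a b p k)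
  where
  eq : ∀ a b p k →
    let x = 9 + a; X = 1 + 2 * x; X′ = 1 + 2 * (1 + 1 * x); Y = 1 + 2 * (5 + b) in
    (3 * (1 + p)) * ((4 * X′ + 3) * Y) + 6 * X′ + (12 * x + (6 * k + 3 * (Y + 2))) +
    (24 * a * b * p + 24 * a * b + 132 * a * p + 108 * a + 180 * b * p + 180 * b + 990 * p + 756)
    ≡ (3 * (1 + p)) * (3 * ((2 * X + 1) * Y)) + 0 + (6 * k + 3 * (Y + 2))
  eq = solve-∀

B₂ˡ⇐1∷B₁ʳʳ : ∀ {x y q h} k → Large x y q →
  Holds (3 * q) k h (B₁ʳʳ (1 + 1 * x) y) → Holds (3 * q) k (x + h) (B₂ˡ x y)
B₂ˡ⇐1∷B₁ʳʳ {h = h} k (large a b p) = improve (9 + a) h (eq a b p k)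
  where
  eq : ∀ a b p k →
    let x = 9 + a; X = 1 + 2 * x; X′ = 1 + 2 * (1 + 1 * x); Y = 1 + 2 * (5 + b) in
    (3 * (1 + p)) * (X′ * (4 * Y + 3)) + 6 * Y + (12 * x + (6 * k + 3 * (Y + 2))) +
    (24 * a * b * p + 24 * a * b + 114 * a * p + 108 * a + 198 * b * p + 180 * b + 900 * p + 756)
    ≡ (3 * (1 + p)) * (3 * ((2 * X + 1) * Y)) + 0 + (6 * k + 3 * (X′ + 2))
  eq = solve-∀

B₂ˡ⇐1∷B₁ : ∀ {x y h} → Large x y 1 →
  Holds 1 0 h (B₁ (1 + 1 * x) y) → Holds 1 0 (x + h) (B₂ˡ x y)
B₂ˡ⇐1∷B₁ {h = h} (large a b _) = improve (9 + a) h (eq a b)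
  where
  eq : ∀ a b →
    let x = 9 + a; X = 1 + 2 * x; X′ = 1 + 2 * (1 + 1 * x); Y = 1 + 2 * (5 + b) in
    1 * (3 * (X′ * Y + (X′ + Y))) + 0 + (12 * x + (6 * 0 + 3 * (Y + 2))) +
    (12 * a * b + 48 * a + 96 * b + 360)
    ≡ 1 * (3 * ((2 * X + 1) * Y)) + 0 + (6 * 0 + 9)
  eq = solve-∀

-- A composition of residue r between large ends satisfies one of these bounds; which of them is the
-- largest depends on x and y.
candidates : Fin 3 → ℕ → ℕ → List Bound
candidates zero             x y = B₀ x y ∷ []
candidates (suc zero)       x y = B₁ˡʳ x y ∷ B₁ˡˡ x y ∷ B₁ʳʳ x y ∷ []
candidates (suc (suc zero)) x y = B₂ˡ x y ∷ B₂ʳ x y ∷ []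

module _ {y : ℕ} (5≤y : 5 ≤ y) where

  private
    large! : ∀ k {x} → 9 ≤ x → Large x y (3 ^ k)
    large! k 9≤x
      with m≤n⇒∃[o]m+o≡n 9≤x | m≤n⇒∃[o]m+o≡n 5≤y | m≤n⇒∃[o]m+o≡n (m^n>0 3 k)
    ... | a , refl | b , refl | p , q≡ = subst (Large _ _) q≡ (large a b p)

    largeLE! : ∀ k {x} → 9 ≤ x → x ≤ y → LargeLE x y (3 ^ k)
    largeLE! k 9≤x x≤y
      with m≤n⇒∃[o]m+o≡n 9≤x | m≤n⇒∃[o]m+o≡n x≤y | m≤n⇒∃[o]m+o≡n (m^n>0 3 k)
    ... | a , refl | b , refl | p , q≡ = subst (LargeLE _ _) q≡ (largeLE a b p)

    largeGE! : ∀ k {x} → y ≤ x → LargeGE x y (3 ^ k)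
    largeGE! k y≤x
      with m≤n⇒∃[o]m+o≡n y≤x | m≤n⇒∃[o]m+o≡n 5≤y | m≤n⇒∃[o]m+o≡n (m^n>0 3 k)
    ... | a , refl | b , refl | p , q≡ =
      subst₂ (λ z → LargeGE z (5 + b)) (cong (5 +_) (+-comm a b)) q≡ (largeGE a b p)

    grow : ∀ d {x} → 9 ≤ x → 9 ≤ 1 + suc d * x
    grow d {x} 9≤x = m≤n⇒m≤1+n (≤-trans 9≤x (m≤m+n x (d * x)))

    exact₁ : ∀ x → Holds 1 0 (x + (1 + 1 * x) * y) (B₁ x y)
    exact₁ x = ≤-reflexive (eq x y)
      where
      eq : ∀ x y → 12 * (x + (1 + 1 * x) * y) + 9 ≡
             1 * (3 * ((1 + 2 * x) * (1 + 2 * y) + ((1 + 2 * x) + (1 + 2 * y)))) + 0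
      eq = solve-∀

    exact₀ : ∀ x → Holds 1 0 (x * y) (B₀ x y)
    exact₀ x = ≤-reflexive (eq x y)
      where
      eq : ∀ x y → 12 * (x * y) + 3 * ((1 + 2 * x) + (1 + 2 * y)) ≡
             1 * (3 * ((1 + 2 * x) * (1 + 2 * y))) + 3
      eq = solve-∀

  -- Simultaneous induction on the composition.  For residue 1 the case k = 0 is left out, because
  -- the bounds B₁ˡʳ, B₁ˡˡ, B₁ʳʳ are then too weak for the induction; the exact value B₁ replaces them.
  meeting≤₀ : ∀ k {x} → 9 ≤ x → (c : Composition (k * 3)) →
              Holds (3 ^ k) k (meeting x y c) (B₀ x y)
  meeting≤₁ : ∀ k {x} → 9 ≤ x → (c : Composition (4 + k * 3)) →
              Any (Holds (3 ^ suc k) (suc k) (meeting x y c)) (candidates (suc zero) x y)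
  meeting≤₂ : ∀ k {x} → 9 ≤ x → (c : Composition (2 + k * 3)) →
              Any (Holds (3 ^ k) k (meeting x y c)) (candidates (suc (suc zero)) x y)

  meeting≤₀ zero          {x} 9≤x [] = exact₀ x
  meeting≤₀ (suc k)       {x} 9≤x (1∷ c) with meeting≤₂ k (grow 0 9≤x) c
  ... | here p         = B₀⇐1∷B₂ˡ k (large! k 9≤x) p
  ... | there (here p) = B₀⇐1∷B₂ʳ k (large! k 9≤x) p
  meeting≤₀ (suc zero)    {x} 9≤x (2∷ 1∷ []) = B₀⇐2∷B₁ (large! 0 9≤x) (exact₁ (1 + 2 * x))
  meeting≤₀ (suc (suc k)) {x} 9≤x (2∷ c) with meeting≤₁ k (grow 1 9≤x) c
  ... | here p                 = B₀⇐2∷B₁ˡʳ (suc k) (large! k 9≤x) p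
  ... | there (here p)         = B₀⇐2∷B₁ˡˡ (suc k) (large! k 9≤x) p
  ... | there (there (here p)) = B₀⇐2∷B₁ʳʳ (suc k) (large! k 9≤x) p
  meeting≤₀ (suc k)       {x} 9≤x (3∷ c) = B₀⇐3∷B₀ k (large! k 9≤x) (meeting≤₀ k (grow 2 9≤x) c)

  meeting≤₁ k       {x} 9≤x (1∷ c) = here (B₁ˡʳ⇐1∷B₀ (suc k) (large! k 9≤x) (meeting≤₀ (suc k) (grow 0 9≤x) c))
  meeting≤₁ k       {x} 9≤x (2∷ c) with meeting≤₂ k (grow 1 9≤x) c
  ... | here p         = there (here (B₁ˡˡ⇐2∷B₂ˡ k (large! k 9≤x) p))
  ... | there (here p) = here (B₁ˡʳ⇐2∷B₂ʳ k (large! k 9≤x) p)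
  meeting≤₁ zero    {x} 9≤x (3∷ 1∷ []) = here (B₁ˡʳ⇐3∷B₁ (large! 0 9≤x) (exact₁ (1 + 3 * x)))
  meeting≤₁ (suc k) {x} 9≤x (3∷ c) with meeting≤₁ k (grow 2 9≤x) c | ≤-total x y
  ... | here p                 | inj₁ x≤y = here (B₁ˡʳ⇐3∷B₁ˡʳ-≤ (suc k) (largeLE! k 9≤x x≤y) p)
  ... | here p                 | inj₂ y≤x = there (there (here (B₁ʳʳ⇐3∷B₁ˡʳ-≥ (suc k) (largeGE! k y≤x) p)))
  ... | there (here p)         | inj₁ x≤y = there (here (B₁ˡˡ⇐3∷B₁ˡˡ-≤ (suc k) (largeLE! k 9≤x x≤y) p))
  ... | there (here p)         | inj₂ y≤x = there (there (here (B₁ʳʳ⇐3∷B₁ˡˡ-≥ (suc k) (largeGE! k y≤x) p)))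
  ... | there (there (here p)) | _        = there (there (here (B₁ʳʳ⇐3∷B₁ʳʳ (suc k) (large! k 9≤x) p)))

  meeting≤₂ zero    {x} 9≤x (1∷ 1∷ []) = here (B₂ˡ⇐1∷B₁ (large! 0 9≤x) (exact₁ (1 + 1 * x)))
  meeting≤₂ (suc k) {x} 9≤x (1∷ c) with meeting≤₁ k (grow 0 9≤x) c
  ... | here p                 = here (B₂ˡ⇐1∷B₁ˡʳ (suc k) (large! k 9≤x) p)
  ... | there (here p)         = here (B₂ˡ⇐1∷B₁ˡˡ (suc k) (large! k 9≤x) p)
  ... | there (there (here p)) = here (B₂ˡ⇐1∷B₁ʳʳ (suc k) (large! k 9≤x) p)
  meeting≤₂ k       {x} 9≤x (2∷ c) = here (B₂ˡ⇐2∷B₀ k (large! k 9≤x) (meeting≤₀ k (grow 1 9≤x) c))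
  meeting≤₂ (suc k) {x} 9≤x (3∷ c) with meeting≤₂ k (grow 2 9≤x) c | ≤-total x y
  ... | here p         | inj₁ x≤y = here (B₂ˡ⇐3∷B₂ˡ-≤ k (largeLE! k 9≤x x≤y) p)
  ... | here p         | inj₂ y≤x = there (here (B₂ʳ⇐3∷B₂ˡ-≥ k (largeGE! k y≤x) p))
  ... | there (here p) | _        = there (here (B₂ʳ⇐3∷B₂ʳ k (large! k 9≤x) p))

  meeting≤ : ∀ r k {n x} → 9 ≤ x → n ≡ toℕ r + k * 3 → (c : Composition n) →
             Any (Holds (3 ^ k) k (meeting x y c)) (candidates r x y)
  meeting≤ zero             k       9≤x refl c       = here (meeting≤₀ k 9≤x c)
  meeting≤ (suc zero)       (suc k) 9≤x refl c       = meeting≤₁ k 9≤x c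
  meeting≤ (suc zero)       zero    {x = x} 9≤x refl (1∷ []) =
    here (weaken (large! 0 9≤x))
    where
    weaken : Large x y 1 → Holds 1 0 (x + (1 + 1 * x) * y) (B₁ˡʳ x y)
    weaken (large a b _) = m+n≤o⇒m≤o _ (≤-reflexive (eq a b))
      where
      eq : ∀ a b → 12 * ((9 + a) + (1 + 1 * (9 + a)) * (5 + b)) + 9 + (4 * a * b + 20 * a + 36 * b + 180) ≡
             1 * ((2 * (1 + 2 * (9 + a)) + 1) * (2 * (1 + 2 * (5 + b)) + 1)) + 0
      eq = solve-∀
  meeting≤ (suc (suc zero)) k       9≤x refl c       = meeting≤₂ k 9≤x c

-- Finite exploration of the ends

-- Peels off parts in all possible ways, starting with x paths into the first vertex, n edges still to
-- be used and g paths already counted, until x ≥ s; the test leaf must then succeed.  The result is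
-- false if fewer than three edges are left while x < s.
explore : ℕ → (ℕ → ℕ → ℕ → Bool) → ℕ → ℕ → ℕ → Bool
explore s leaf (suc (suc (suc n))) g x =
  if s ≤ᵇ x then leaf (3 + n) g x
  else (explore s leaf (suc (suc n)) (g + x) (1 + 1 * x) ∧
        (explore s leaf (suc n) (g + x) (1 + 2 * x) ∧
         explore s leaf n (g + x) (1 + 3 * x)))
explore s leaf n g x = (s ≤ᵇ x) ∧ leaf n g x

module _ {s : ℕ} {leaf : ℕ → ℕ → ℕ → Bool} (P : ℕ → ℕ → ℕ → Set)
  (sound : ∀ n g x → s ≤ x → T (leaf n g x) → P n g x)
  (step  : ∀ n g x → P (2 + n) (g + x) (1 + 1 * x) → P (1 + n) (g + x) (1 + 2 * x) →
           P n (g + x) (1 + 3 * x) → P (3 + n) g x)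
  where

  private
    if-elim : ∀ b {p q} → T (if b then p else q) → (T b × T p) ⊎ T q
    if-elim true  ok = inj₁ (tt , ok)
    if-elim false ok = inj₂ ok

    at-leaf : ∀ n g x → T ((s ≤ᵇ x) ∧ leaf n g x) → P n g x
    at-leaf n g x ok =
      let s≤x , leaf-ok = Equivalence.to T-∧ ok in sound n g x (≤ᵇ⇒≤ s x s≤x) leaf-ok

  explore-sound : ∀ n g x → T (explore s leaf n g x) → P n g x
  explore-sound 0 g x ok = at-leaf 0 g x ok
  explore-sound 1 g x ok = at-leaf 1 g x ok
  explore-sound 2 g x ok = at-leaf 2 g x ok
  explore-sound (suc (suc (suc n))) g x ok =
    [ (λ (s≤x , leaf-ok) → sound (3 + n) g x (≤ᵇ⇒≤ s x s≤x) leaf-ok)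
    , (λ ok′ → let ok₁ , ok₂₃ = Equivalence.to T-∧ ok′
                   ok₂ , ok₃  = Equivalence.to T-∧ ok₂₃
               in step n g x (explore-sound (suc (suc n)) _ _ ok₁) (explore-sound (suc n) _ _ ok₂)
                             (explore-sound n _ _ ok₃))
    ]′ (if-elim (s ≤ᵇ x) ok)

-- The statement to be explored, uniform in t: if g paths are already counted and n + 3 t edges
-- remain between x and y, then 12 (number of paths) + 6 t + 15 ≤ A 3 ^ t + B.
AtMost : ℕ → ℕ → ℕ → ℕ → ℕ → ℕ → Set
AtMost A B y n g x = ∀ t (c : Composition (n + t * 3)) →
  12 * (g + meeting x y c) + (6 * t + 15) ≤ A * 3 ^ t + B

AtMost-step : ∀ A B y n g x → AtMost A B y (2 + n) (g + x) (1 + 1 * x) →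
  AtMost A B y (1 + n) (g + x) (1 + 2 * x) → AtMost A B y n (g + x) (1 + 3 * x) →
  AtMost A B y (3 + n) g x
AtMost-step A B y n g x p₁ p₂ p₃ t = λ where
    (1∷ c) → reassociate (p₁ t c)
    (2∷ c) → reassociate (p₂ t c)
    (3∷ c) → reassociate (p₃ t c)
  where
  reassociate : ∀ {h} → 12 * (g + x + h) + (6 * t + 15) ≤ A * 3 ^ t + B →
                12 * (g + (x + h)) + (6 * t + 15) ≤ A * 3 ^ t + B
  reassociate {h} = subst (λ z → 12 * z + (6 * t + 15) ≤ A * 3 ^ t + B) (+-assoc g x h)

-- By reversal the roles of the two ends may be exchanged.
AtMost-swap : ∀ A B n g x y → AtMost A B x n g y → AtMost A B y n g x
AtMost-swap A B n g x y p t c =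
  subst (λ z → 12 * (g + z) + (6 * t + 15) ≤ A * 3 ^ t + B) (meeting-reverse x y c) (p t (reverse c))

residue : ∀ n → ∃₂ λ k (r : Fin 3) → n ≡ toℕ r + k * 3
residue 0 = 0 , zero , refl
residue 1 = 0 , suc zero , refl
residue 2 = 0 , suc (suc zero) , refl
residue (suc (suc (suc n))) = let k , r , eq = residue n in
  suc k , r , trans (cong (3 +_) eq) (shift (toℕ r) k)
  where
  shift : ∀ r k → 3 + (r + k * 3) ≡ r + (3 + k * 3)
  shift = solve-∀

-- A numerical criterion for a bound to imply AtMost for all t at once: the leading coefficient is at
-- most A, and the inequality holds for t = 0.
fits : ℕ → ℕ → ℕ → ℕ → Bound → Bool
fits A B k g b = (3 ^ k * slope b ≤ᵇ A) ∧
                 (12 * g + (3 ^ k * slope b + gain b + 15) ≤ᵇ loss b + 6 * k + (A + B))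

fits-sound : ∀ A B k g b → T (fits A B k g b) → ∀ t h → Holds (3 ^ (k + t)) (k + t) h b →
             12 * (g + h) + (6 * t + 15) ≤ A * 3 ^ t + B
fits-sound A B k g b ok t h hyp = +-cancelʳ-≤ (6 * k + loss b) _ _ (begin
  12 * (g + h) + (6 * t + 15) + (6 * k + loss b)
    ≡⟨ eq₁ g h t k (loss b) ⟩
  12 * h + (6 * (k + t) + loss b) + (12 * g + 15)
    ≤⟨ +-monoˡ-≤ (12 * g + 15) hyp ⟩
  3 ^ (k + t) * slope b + gain b + (12 * g + 15)
    ≡⟨ cong (λ z → z * slope b + gain b + (12 * g + 15)) (trans (^-distribˡ-+-* 3 k t) (cong (3 ^ k *_) 3ᵗ≡)) ⟩
  3 ^ k * (1 + z) * slope b + gain b + (12 * g + 15)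
    ≡⟨ eq₂ (3 ^ k) z (slope b) (gain b) g ⟩
  12 * g + (3 ^ k * slope b + gain b + 15) + 3 ^ k * slope b * z
    ≤⟨ +-mono-≤ at-zero (*-monoˡ-≤ z leading) ⟩
  loss b + 6 * k + (A + B) + A * z
    ≡⟨ eq₃ A B z (loss b) k ⟩
  A * (1 + z) + B + (6 * k + loss b)
    ≡⟨ cong (λ q → A * q + B + (6 * k + loss b)) (sym 3ᵗ≡) ⟩
  A * 3 ^ t + B + (6 * k + loss b) ∎)
  where
  open ≤-Reasoning
  both = Equivalence.to T-∧ ok
  leading : 3 ^ k * slope b ≤ A
  leading = ≤ᵇ⇒≤ _ _ (proj₁ both)
  at-zero : 12 * g + (3 ^ k * slope b + gain b + 15) ≤ loss b + 6 * k + (A + B)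
  at-zero = ≤ᵇ⇒≤ _ _ (proj₂ both)
  z : ℕ
  z = proj₁ (m≤n⇒∃[o]m+o≡n (m^n>0 3 t))
  3ᵗ≡ : 3 ^ t ≡ 1 + z
  3ᵗ≡ = sym (proj₂ (m≤n⇒∃[o]m+o≡n (m^n>0 3 t)))
  eq₁ : ∀ g h t k l → 12 * (g + h) + (6 * t + 15) + (6 * k + l) ≡
                      12 * h + (6 * (k + t) + l) + (12 * g + 15)
  eq₁ = solve-∀
  eq₂ : ∀ q z s r g → q * (1 + z) * s + r + (12 * g + 15) ≡
                      12 * g + (q * s + r + 15) + q * s * z
  eq₂ = solve-∀
  eq₃ : ∀ A B z l k → l + 6 * k + (A + B) + A * z ≡ A * (1 + z) + B + (6 * k + l)
  eq₃ = solve-∀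

all-fit : ℕ → ℕ → ℕ → ℕ → ℕ → ℕ → Bool
all-fit A B x n g y = let k , r , _ = residue n in all (fits A B k g) (candidates r x y)

all-fit-sound : ∀ A B x → 9 ≤ x → ∀ n g y → 5 ≤ y → T (all-fit A B x n g y) → AtMost A B y n g x
all-fit-sound A B x 9≤x n g y 5≤y ok t c with residue n
... | k , r , refl =
  let i      = meeting≤ 5≤y r (k + t) 9≤x (shift (toℕ r) k t) c
      p , q  = All.lookupAny (all⁺ (fits A B k g) (candidates r x y) ok) i
  in fits-sound A B k g (Any.lookup i) p t (meeting x y c) q
  where
  shift : ∀ r k t → r + k * 3 + t * 3 ≡ r + (k + t) * 3
  shift = solve-∀

-- The left end is explored first, until x ≥ 9, and then the right end, until y ≥ 5.
check : ℕ → ℕ → ℕ → Bool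
check A B n = explore 9 (λ m g x → explore 5 (all-fit A B x) m g 1) n 0 1

-- The compositions in question have an index that is only propositionally equal to n + t * 3.
check-sound : ∀ A B n → T (check A B n) → ∀ t {m} → m ≡ n + t * 3 → (c : Composition m) →
              12 * total c + (6 * t + 15) ≤ A * 3 ^ t + B
check-sound A B n ok t refl c =
  subst (λ z → 12 * z + (6 * t + 15) ≤ A * 3 ^ t + B) (sym (total≡meeting c))
    (explore-sound (AtMost A B 1) outer (AtMost-step A B 1) n 0 1 ok t c)
  where
  inner : ∀ x → 9 ≤ x → ∀ n g y → 5 ≤ y → T (all-fit A B x n g y) → AtMost A B x n g y
  inner x 9≤x n g y 5≤y ok = AtMost-swap A B n g y x (all-fit-sound A B x 9≤x n g y 5≤y ok)
  outer : ∀ n g x → 9 ≤ x → T (explore 5 (all-fit A B x) n g 1) → AtMost A B 1 n g x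
  outer n g x 9≤x ok = AtMost-swap A B n g x 1
    (explore-sound (AtMost A B x) (inner x 9≤x) (AtMost-step A B x) n g 1 ok)

-- The exploration starts with 18, 16 and 17 edges, the least number N ≥ 16 in each residue class.  The
-- constants are those for which the optimal compositions give equality, for example
-- 29403 = 3 * 121 * 3 ^ 4 for the composition 1,2,3,...,3,2,1.
total≤₀ : ∀ t {n} → n ≡ 18 + t * 3 → (c : Composition n) →
          12 * total c + (6 * t + 15) ≤ 29403 * 3 ^ t + 0
total≤₀ = check-sound 29403 0 18 tt

total≤₁ : ∀ t {n} → n ≡ 16 + t * 3 → (c : Composition n) →
          12 * total c + (6 * t + 15) ≤ 14283 * 3 ^ t + 60
total≤₁ = check-sound 14283 60 16 tt

total≤₂ : ∀ t {n} → n ≡ 17 + t * 3 → (c : Composition n) →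
          12 * total c + (6 * t + 15) ≤ 20493 * 3 ^ t + 30
total≤₂ = check-sound 20493 30 17 tt

-- Domination of a vertex of a graph by new parts of a composition

-- The composition c with r parts 1 prepended.
ones : ∀ r {n} → Composition n → Composition (r + n)
ones zero    c = c
ones (suc r) c = 1∷ ones r c

rooted-ones : ∀ r {n} (c : Composition n) → rooted (ones r c) ≡ r + rooted c
rooted-ones zero    c = refl
rooted-ones (suc r) c = cong suc (trans (*-identityˡ _) (rooted-ones r c))

total-ones : ∀ r {n} (c : Composition n) → total c + r * suc (rooted c) ≤ total (ones r c)
total-ones zero    c = ≤-reflexive (+-identityʳ (total c))
total-ones (suc r) c = begin
  total c + suc r * suc (rooted c)                        ≤⟨ m≤m+n _ r ⟩
  total c + suc r * suc (rooted c) + r                    ≡⟨ eq (total c) r (rooted c) ⟩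
  total c + r * suc (rooted c) + (1 + 1 * (r + rooted c)) ≡⟨ cong (λ z → total c + r * suc (rooted c) + (1 + 1 * z))
                                                                  (sym (rooted-ones r c)) ⟩
  total c + r * suc (rooted c) + rooted (ones (suc r) c)  ≤⟨ +-monoˡ-≤ _ (total-ones r c) ⟩
  total (ones (suc r) c)                                  ∎
  where
  open ≤-Reasoning
  eq : ∀ T r R → T + suc r * suc R + r ≡ T + r * suc R + (1 + 1 * (r + R))
  eq = solve-∀

rooted≥1 : ∀ {n} (c : Composition n) → 1 ≤ rooted c
rooted≥1 []     = ≤-refl
rooted≥1 (1∷ c) = s≤s z≤n
rooted≥1 (2∷ c) = s≤s z≤n
rooted≥1 (3∷ c) = s≤s z≤n

rooted≥2 : ∀ {n} (c : Composition n) → 1 ≤ n → 2 ≤ rooted c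
rooted≥2 (1∷ c) _ = s≤s (≤-trans (rooted≥1 c) (m≤m+n _ _))
rooted≥2 (2∷ c) _ = s≤s (≤-trans (rooted≥1 c) (m≤m+n _ _))
rooted≥2 (3∷ c) _ = s≤s (≤-trans (rooted≥1 c) (m≤m+n _ _))

-- Prepending a part of any size suc d; a part of size at least 4 is split into 2 and the remainder,
-- which is no loss.
prepend-part : ∀ d {n} (c : Composition n) → ∃ λ (c′ : Composition (suc d + n)) →
  1 + suc d * rooted c ≤ rooted c′ × total c + (1 + suc d * rooted c) ≤ total c′
prepend-part 0 c = 1∷ c , ≤-refl , ≤-refl
prepend-part 1 c = 2∷ c , ≤-refl , ≤-refl
prepend-part 2 c = 3∷ c , ≤-refl , ≤-refl
prepend-part (suc (suc (suc d))) c with prepend-part (suc d) c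
... | c′ , root≤ , total≤ = 2∷ c′ , rooted-large , (begin
  total c + (1 + (4 + d) * rooted c)   ≤⟨ +-mono-≤ (≤-trans (m≤m+n _ _) total≤) rooted-large ⟩
  total c′ + rooted (2∷ c′)            ∎)
  where
  open ≤-Reasoning
  eq : ∀ d R → 1 + 2 * (1 + (2 + d) * R) ≡ 1 + (4 + d) * R + (2 + d * R)
  eq = solve-∀
  rooted-large : 1 + (4 + d) * rooted c ≤ rooted (2∷ c′)
  rooted-large = begin
    1 + (4 + d) * rooted c                        ≤⟨ m≤m+n _ _ ⟩
    1 + (4 + d) * rooted c + (2 + d * rooted c)   ≡⟨ eq d (rooted c) ⟨
    1 + 2 * (1 + (2 + d) * rooted c)              ≤⟨ s≤s (*-monoʳ-≤ 2 root≤) ⟩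
    rooted (2∷ c′)                                ∎

-- The step of the reduction to linear graphs: a vertex with r edges into sinks that are counted once and
-- t other edges, whose targets have at most rooted c paths leaving them, is dominated by r parts 1
-- followed by the part t.  The last summand r pays for the r sinks.  The exceptional case t = 0,
-- rooted c = 1 has to be excluded: for r = 1 it would yield one path too few.
absorb : ∀ r t {n} (c : Composition n) → 1 ≤ r + t → 1 ≤ t ⊎ 2 ≤ rooted c →
  ∃ λ (c′ : Composition (t + (r + n))) →
    rooted c ≤ rooted c′ × 1 + r + t * rooted c ≤ rooted c′ ×
    total c + (1 + r + t * rooted c) + r ≤ total c′
absorb r (suc t) c _ _ with prepend-part t (ones r c)
... | c′ , root≤ , total≤ =
  c′ , ≤-trans at-least-old (≤-trans vertex root≤) , ≤-trans vertex root≤ , (begin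
  total c + (1 + r + suc t * rooted c) + r                 ≤⟨ +-monoˡ-≤ r (+-monoʳ-≤ (total c) vertex) ⟩
  total c + new + r                                        ≤⟨ +-monoʳ-≤ (total c + new) (m≤m*n r (suc (rooted c))) ⟩
  total c + new + r * suc (rooted c)                       ≡⟨ eq (total c) new (r * suc (rooted c)) ⟩
  total c + r * suc (rooted c) + new                       ≤⟨ +-monoˡ-≤ new (total-ones r c) ⟩
  total (ones r c) + new                                   ≤⟨ total≤ ⟩
  total c′                                                 ∎)
  where
  open ≤-Reasoning
  new : ℕ
  new = 1 + suc t * rooted (ones r c)
  eq : ∀ a b c → a + b + c ≡ a + c + b
  eq = solve-∀
  eq′ : ∀ r t R → 1 + r + suc t * R + t * r ≡ 1 + suc t * (r + R)
  eq′ = solve-∀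
  at-least-old : rooted c ≤ 1 + r + suc t * rooted c
  at-least-old = ≤-trans (m≤m+n (rooted c) (t * rooted c)) (m≤n+m _ (1 + r))
  vertex : 1 + r + suc t * rooted c ≤ new
  vertex = m+n≤o⇒m≤o _ (≤-reflexive (trans (eq′ r t (rooted c))
             (cong (λ z → 1 + suc t * z) (sym (rooted-ones r c)))))
absorb (suc r) zero c _ (inj₂ 2≤R) = ones (suc r) c ,
  ≤-trans (m≤n+m (rooted c) (suc r)) (≤-reflexive (sym (rooted-ones (suc r) c))) , (begin
    1 + suc r + 0                ≡⟨ eq r ⟩
    suc r + 1                    ≤⟨ +-monoʳ-≤ (suc r) (rooted≥1 c) ⟩
    suc r + rooted c             ≡⟨ rooted-ones (suc r) c ⟨
    rooted (ones (suc r) c)      ∎) , (begin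
    total c + (1 + suc r + 0) + suc r       ≤⟨ m≤m+n _ r ⟩
    total c + (1 + suc r + 0) + suc r + r   ≡⟨ eq′ (total c) r ⟩
    total c + suc r * 3                     ≤⟨ +-monoʳ-≤ (total c) (*-monoʳ-≤ (suc r) (s≤s 2≤R)) ⟩
    total c + suc r * suc (rooted c)        ≤⟨ total-ones (suc r) c ⟩
    total (ones (suc r) c)                  ∎)
  where
  open ≤-Reasoning
  eq : ∀ r → 1 + suc r + 0 ≡ suc r + 1
  eq = solve-∀
  eq′ : ∀ T r → T + (1 + suc r + 0) + suc r + r ≡ T + suc r * 3
  eq′ = solve-∀
-- Counting and covering

-- A disjoint decomposition of a predicate decomposes the count.
length-filter-split : ∀ {A : Set} {P Q R : A → Set} (P? : Decidable P) (Q? : Decidable Q) (R? : Decidable R) →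
  (∀ {x} → P x → Q x ⊎ R x) → (∀ {x} → Q x → P x) → (∀ {x} → R x → P x) →
  (∀ {x} → Q x → ¬ R x) → ∀ xs →
  length (filter P? xs) ≡ length (filter Q? xs) + length (filter R? xs)
length-filter-split P? Q? R? split fromQ fromR disjoint [] = refl
length-filter-split P? Q? R? split fromQ fromR disjoint (x ∷ xs)
  with ih ← length-filter-split P? Q? R? split fromQ fromR disjoint xs | P? x | Q? x | R? x
... | yes p | yes q | no ¬r = cong suc ih
... | yes p | no ¬q | yes r = trans (cong suc ih) (sym (+-suc _ _))
... | no ¬p | no ¬q | no ¬r = ih
... | yes p | no ¬q | no ¬r = contradiction (split p) [ ¬q , ¬r ]′
... | _     | yes q | yes r = contradiction r (disjoint q)
... | no ¬p | yes q | _     = contradiction (fromQ q) ¬p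
... | no ¬p | _     | yes r = contradiction (fromR r) ¬p

length-filter-pos : ∀ {A : Set} {P : A → Set} (P? : Decidable P) {x xs} → x ∈ xs → P x →
  1 ≤ length (filter P? xs)
length-filter-pos P? {xs = xs} x∈xs px with filter P? xs | ∈-filter⁺ P? x∈xs px
... | _ ∷ _ | _ = s≤s z≤n

-- The elements that satisfy C can be listed, possibly with repetitions, by a list of length at most b.
Cover : {A : Set} → (A → Set) → ℕ → Set
Cover {A} C b = ∃ λ (xs : List A) → length xs ≤ b × (∀ {q} → C q → q ∈ xs)

module _ {A : Set} where

  Cover-weaken : ∀ {C D : A → Set} {a b} → (∀ {q} → D q → C q) → a ≤ b → Cover C a → Cover D b
  Cover-weaken D⊆C a≤b (xs , len , cov) = xs , ≤-trans len a≤b , λ d → cov (D⊆C d)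

  Cover-singleton : ∀ (x : A) → Cover (_≡ x) 1
  Cover-singleton x = x ∷ [] , ≤-refl , λ eq → here eq

  Cover-⊎ : ∀ {C D : A → Set} {a b} → Cover C a → Cover D b → Cover (λ q → C q ⊎ D q) (a + b)
  Cover-⊎ (xs , len , cov) (ys , len′ , cov′) = xs ++ ys ,
    ≤-trans (≤-reflexive (length-++ xs)) (+-mono-≤ len len′) ,
    [ (λ c → ∈-++⁺ˡ (cov c)) , (λ d → ∈-++⁺ʳ xs (cov′ d)) ]′

  Cover-Any : ∀ {B : Set} {C : B → A → Set} {b} {is : List B} →
    All (λ i → Cover (C i) b) is → Cover (λ q → Any (λ i → C i q) is) (length is * b)
  Cover-Any []         = [] , z≤n , λ ()
  Cover-Any (cv ∷ cvs) = Cover-weaken Any.toSum ≤-refl (Cover-⊎ cv (Cover-Any cvs))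

  Cover-map : ∀ {B : Set} {C : A → Set} {b} (f : A → B) → Cover C b →
    Cover (λ q → ∃ λ a → C a × q ≡ f a) b
  Cover-map f (xs , len , cov) = map f xs , ≤-trans (≤-reflexive (length-map f xs)) len ,
    λ (a , ca , eq) → subst (_∈ map f xs) (sym eq) (∈-map⁺ f (cov ca))

Cover⇒≤ : ∀ {A : Set} {m b} → A ↔ Fin m → Cover {A} (λ _ → ⊤) b → m ≤ b
Cover⇒≤ {m = m} paths (xs , len , cov) = ≤-trans (injective⇒≤ {f = position} position-injective) len
  where
  open Inverse paths
  position : Fin m → Fin (length xs)
  position i = Any.index (cov {from i} tt)
  position-injective : ∀ {i j} → position i ≡ position j → i ≡ j
  position-injective {i} {j} eq = begin
    i                          ≡⟨ strictlyInverseˡ i ⟨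
    to (from i)                ≡⟨ cong to (lookup-index (cov {from i} tt)) ⟩
    to (lookup xs (position i)) ≡⟨ cong (λ p → to (lookup xs p)) eq ⟩
    to (lookup xs (position j)) ≡⟨ cong to (lookup-index (cov {from j} tt)) ⟨
    to (from j)                ≡⟨ strictlyInverseˡ j ⟩
    j                          ∎
    where open ≡-Reasoning

-- From graphs to compositions

-- A connected graph with finitely many edges and paths, and at least one edge.  The finiteness of
-- the set of paths stands for acyclicity: it guarantees that longest paths exist.
module Reduction (E : Graph) {N m : ℕ} (edges : HasCardinality (Graph.Edge E) N)
  (connected : Graph.Connected E) (paths : HasCardinality (Graph.FP E) m) (e₁ : Graph.Edge E)
  where

  open Graph E

  trivial : Vertex → FP
  trivial v = v , v , ε

  -- The trivial paths embed the vertices into a finite set, which makes their equality decidable.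
  abstract

    index : Vertex → Fin m
    index v = Inverse.to paths (trivial v)

    index-injective : ∀ {u v} → index u ≡ index v → u ≡ v
    index-injective {u} {v} eq = cong proj₁ (begin
      trivial u                        ≡⟨ Inverse.strictlyInverseʳ paths (trivial u) ⟨
      Inverse.from paths (index u)     ≡⟨ cong (Inverse.from paths) eq ⟩
      Inverse.from paths (index v)     ≡⟨ Inverse.strictlyInverseʳ paths (trivial v) ⟩
      trivial v                        ∎)
      where open ≡-Reasoning

    _≟ᵛ_ : (u v : Vertex) → Dec (u ≡ v)
    u ≟ᵛ v = map′ index-injective (cong index) (index u Fin.≟ index v)

  es : List Edge
  es = tabulate (Inverse.from edges)

  ∈-es : ∀ e → e ∈ es
  ∈-es e = subst (_∈ es) (Inverse.strictlyInverseʳ edges e) (∈-tabulate⁺ (Inverse.to edges e))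

  allPaths : List FP
  allPaths = tabulate (Inverse.from paths)

  ∈-allPaths : ∀ q → q ∈ allPaths
  ∈-allPaths q = subst (_∈ allPaths) (Inverse.strictlyInverseʳ paths q) (∈-tabulate⁺ (Inverse.to paths q))

  len : ∀ {u v} → Star _⟶_ u v → ℕ
  len ε       = 0
  len (_ ◅ p) = suc (len p)

  lenFrom : Vertex → FP → ℕ
  lenFrom u (v , _ , p) = if does (v ≟ᵛ u) then len p else 0

  -- The length of a longest path from a vertex, the maximum being taken over all paths that begin
  -- there; paths with another beginning are given the length 0 by lenFrom.
  abstract

    rank : Vertex → ℕ
    rank u = max 0 (map (lenFrom u) allPaths)

    len≤rank : ∀ {u v} (p : Star _⟶_ u v) → len p ≤ rank u
    len≤rank {u} {v} p = subst (_≤ rank u) self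
      (All.lookup (xs≤max 0 (map (lenFrom u) allPaths)) (∈-map⁺ (lenFrom u) (∈-allPaths (u , v , p))))
      where
      self : lenFrom u (u , v , p) ≡ len p
      self = cong (if_then len p else 0) (dec-true (u ≟ᵛ u) refl)

    rank-decreasing : ∀ e → rank (target e) < rank (source e)
    rank-decreasing e = max<v⁺ (len≤rank ((e , refl , refl) ◅ ε)) (map⁺ (All.universal bounded allPaths))
      where
      if-< : ∀ {A : Set} (A? : Dec A) {a b} → (A → a < b) → 0 < b → (if does A? then a else 0) < b
      if-< (yes p) a<b _   = a<b p
      if-< (no _)  _   0<b = 0<b
      bounded : ∀ q → lenFrom (target e) q < rank (source e)
      bounded (v , w , p) = if-< (v ≟ᵛ target e) (λ { refl → len≤rank ((e , refl , refl) ◅ p) })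
                                                 (len≤rank ((e , refl , refl) ◅ ε))

    -- The numbering of the vertices: the rank decides, and the index, which is less than m, separates
    -- vertices of equal rank.
    ρ : Vertex → ℕ
    ρ u = toℕ (index u) + rank u * m

    rank<⇒ρ< : ∀ {u v} → rank u < rank v → ρ u < ρ v
    rank<⇒ρ< {u} {v} lt = begin-strict
      toℕ (index u) + rank u * m   <⟨ +-monoˡ-< (rank u * m) (toℕ<n (index u)) ⟩
      suc (rank u) * m             ≤⟨ *-monoˡ-≤ m lt ⟩
      rank v * m                   ≤⟨ m≤n+m _ _ ⟩
      ρ v                          ∎
      where open ≤-Reasoning

    ρ-decreasing : ∀ e → ρ (target e) < ρ (source e)
    ρ-decreasing e = rank<⇒ρ< (rank-decreasing e)

    ρ-injective : ∀ {u v} → ρ u ≡ ρ v → u ≡ v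
    ρ-injective {u} {v} eq with <-cmp (rank u) (rank v)
    ... | tri< lt _ _ = contradiction eq (<⇒≢ (rank<⇒ρ< lt))
    ... | tri> _ _ gt = contradiction (sym eq) (<⇒≢ (rank<⇒ρ< gt))
    ... | tri≈ _ same _ = index-injective (toℕ-injective (+-cancelʳ-≡ (rank v * m) _ _
            (subst (λ r → toℕ (index u) + r * m ≡ ρ v) same eq)))

  -- Nonsink is the positive form of the negation of Sink.
  Sink Nonsink : Vertex → Set
  Sink v    = ∀ e → source e ≢ v
  Nonsink v = ∃ λ e → source e ≡ v

  nonsink⊎sink : ∀ v → Nonsink v ⊎ Sink v
  nonsink⊎sink v with Any.any? (λ e → source e ≟ᵛ v) es
  ... | yes p = inj₁ (Any.satisfied p)
  ... | no ¬p = inj₂ λ e eq → ¬p (lose (∈-es e) eq)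

  Sink? : ∀ v → Dec (Sink v)
  Sink? v with nonsink⊎sink v
  ... | inj₁ (e , eq) = no λ sink → sink e eq
  ... | inj₂ sink     = yes sink

  -- An edge that leaves the first vertex with outgoing edges; by minimality its target s₀ is a sink.
  abstract

    e₀ : Edge
    e₀ = argmin (λ e → ρ (source e)) e₁ es

    e₀-minimal : ∀ e → ρ (source e₀) ≤ ρ (source e)
    e₀-minimal e = All.lookup (f[argmin]≤f[xs] e₁ es) (∈-es e)

  s₀ : Vertex
  s₀ = target e₀

  -- The edges into sinks other than s₀; they contribute only one path each to the count at their source.
  Pendant : Edge → Set
  Pendant e = Sink (target e) × target e ≢ s₀

  Pendant? : Decidable Pendant
  Pendant? e = Sink? (target e) ×-dec ¬? (target e ≟ᵛ s₀)

  -- The position of the source of an edge in the numbering, relative to k.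
  At Below : ℕ → Edge → Set
  At    k e = ρ (source e) ≡ k
  Below k e = ρ (source e) < k

  At? : ∀ k → Decidable (At k)
  At? k e = ρ (source e) ≟ k

  Below? : ∀ k → Decidable (Below k)
  Below? k e = ρ (source e) <? k

  pendantAt otherAt : ∀ k → Decidable _
  pendantAt k e = At? k e ×-dec Pendant? e
  otherAt k e = At? k e ×-dec ¬? (Pendant? e)

  pendantBelow : ∀ k → Decidable _
  pendantBelow k e = Below? k e ×-dec Pendant? e

  count : {P : Edge → Set} → Decidable P → ℕ
  count P? = length (filter P? es)

  below-suc : ∀ k → count (Below? (suc k)) ≡ count (otherAt k) + (count (pendantAt k) + count (Below? k))
  below-suc k = trans
    (length-filter-split (Below? (suc k)) (otherAt k) rest?
      (λ {e} lt → [ (λ lt′ → inj₂ (inj₂ lt′)) , (λ eq → at e eq) ]′ (m<1+n⇒m<n∨m≡n lt))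
      (λ (eq , _) → s≤s (≤-reflexive eq))
      [ (λ (eq , _) → s≤s (≤-reflexive eq)) , (λ lt → m<n⇒m<1+n lt) ]′
      (λ (eq , ¬p) → [ (λ (_ , p) → ¬p p) , (λ lt → <⇒≢ lt eq) ]′) es)
    (cong (count (otherAt k) +_)
      (length-filter-split rest? (pendantAt k) (Below? k)
        (λ p → p) inj₁ inj₂ (λ (eq , _) lt → <⇒≢ lt eq) es))
    where
    rest? : Decidable (λ e → (At k e × Pendant e) ⊎ Below k e)
    rest? e = pendantAt k e ⊎-dec Below? k e
    at : ∀ e → At k e → (At k e × ¬ Pendant e) ⊎ ((At k e × Pendant e) ⊎ Below k e)
    at e eq with Pendant? e
    ... | yes p = inj₂ (inj₁ (eq , p))
    ... | no ¬p = inj₁ (eq , ¬p)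

  pendantBelow-suc : ∀ k → count (pendantBelow (suc k)) ≡ count (pendantAt k) + count (pendantBelow k)
  pendantBelow-suc k = length-filter-split (pendantBelow (suc k)) (pendantAt k) (pendantBelow k)
      (λ (lt , p) → [ (λ lt′ → inj₂ (lt′ , p)) , (λ eq → inj₁ (eq , p)) ]′ (m<1+n⇒m<n∨m≡n lt))
      (λ (eq , p) → s≤s (≤-reflexive eq) , p)
      (λ (lt , p) → m<n⇒m<1+n lt , p)
      (λ (eq , _) (lt , _) → <⇒≢ lt eq) es

  -- The paths that begin at u.
  From : Vertex → FP → Set
  From u q = proj₁ q ≡ u

  -- The path e followed by the given one; arbitrary when that path does not begin at the target of e.
  prepend : ∀ e → FP → FP
  prepend e (v , w , p) with target e ≟ᵛ v
  ... | yes eq = source e , w , (e , refl , eq) ◅ p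
  ... | no _   = v , w , p

  prepend-◅ : ∀ e {w} (p : Star _⟶_ (target e) w) →
    prepend e (target e , w , p) ≡ (source e , w , (e , refl , refl) ◅ p)
  prepend-◅ e p with target e ≟ᵛ target e
  ... | yes refl = refl
  ... | no ¬eq   = contradiction refl ¬eq

  -- The paths whose first edge is e.
  Through : Edge → FP → Set
  Through e q = ∃ λ q′ → From (target e) q′ × q ≡ prepend e q′

  through-◅ : ∀ {u w} e (eq : source e ≡ u) (p : Star _⟶_ (target e) w) →
    Through e (u , w , (e , eq , refl) ◅ p)
  through-◅ e refl p = (target e , _ , p) , refl , sym (prepend-◅ e p)

  From-sink : ∀ {u} → Sink u → Cover (From u) 1
  From-sink {u} sink = Cover-weaken only-trivial ≤-refl (Cover-singleton (trivial u))
    where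
    only-trivial : ∀ {q} → From u q → q ≡ trivial u
    only-trivial {_ , _ , ε}                refl = refl
    only-trivial {_ , _ , (e , eq , _) ◅ _} refl = contradiction eq (sink e)

  -- Connectedness is used here only: the first edge of an undirected path from a sink to another vertex
  -- points into the sink.
  incoming : ∀ {u} → Sink u → ∃ λ e → target e ≡ u
  incoming {u} sink with connected u (source e₁)
  ... | ε                        = contradiction refl (sink e₁)
  ... | fwd (e , eq , _) ◅ _     = contradiction eq (sink e)
  ... | bwd (e , _ , eq) ◅ _     = e , eq

  FromNonsinkBelow : ℕ → FP → Set
  FromNonsinkBelow k (u , _) = Nonsink u × ρ u < k

  -- The outcome after treating the vertices numbered below k: a composition of the number of edges that
  -- leave them, whose value rooted bounds the number of paths leaving each single one of the
  -- vertices that are not sinks, and whose value total bounds the number of all paths leaving these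
  -- vertices, plus one for each pendant edge leaving them, plus one for s₀.
  record Processed (k : ℕ) : Set where
    field
      {n}         : ℕ
      n≡          : n ≡ count (Below? k)
      composition : Composition n
      from-vertex : ∀ e → Below k e → Cover (From (source e)) (rooted composition)
      size        : ℕ
      from-below  : Cover (FromNonsinkBelow k) size
      size≤       : size + count (pendantBelow k) + 1 ≤ total composition

  process-zero : Processed 0
  process-zero = record
    { n≡          = sym (cong length (filter-none (Below? 0) (All.universal (λ _ ()) es)))
    ; composition = []
    ; from-vertex = λ _ ()
    ; size        = 0
    ; from-below  = [] , z≤n , λ ()
    ; size≤       = ≤-reflexive (cong (λ xs → length xs + 1)
                      (filter-none (pendantBelow 0) (All.universal (λ _ ()) es)))
    }

  process-suc : ∀ k → Processed k → Processed (suc k)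
  -- By injectivity of the numbering all edges of position k leave the same vertex.
  process-suc k done with Any.any? (At? k) es
  ... | no none = record
    { n≡          = trans n≡ (sym (trans (below-suc k) (cong₂ (λ a b → a + (b + count (Below? k))) t≡0 r≡0)))
    ; composition = composition
    ; from-vertex = λ e lt → from-vertex e (still-below e lt)
    ; size        = size
    ; from-below  = Cover-weaken (λ { {q} ((e , eq) , lt) → (e , eq) ,
                      subst (λ v → ρ v < k) eq (still-below e (subst (λ v → ρ v < suc k) (sym eq) lt)) })
                      ≤-refl from-below
    ; size≤       = subst (λ z → size + z + 1 ≤ total composition)
                      (sym (trans (pendantBelow-suc k) (cong (_+ count (pendantBelow k)) r≡0))) size≤
    }
    where
    open Processed done
    ¬at : ∀ e → ¬ At k e
    ¬at e eq = none (lose (∈-es e) eq)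
    t≡0 : count (otherAt k) ≡ 0
    t≡0 = cong length (filter-none (otherAt k) (All.universal (λ e (eq , _) → ¬at e eq) es))
    r≡0 : count (pendantAt k) ≡ 0
    r≡0 = cong length (filter-none (pendantAt k) (All.universal (λ e (eq , _) → ¬at e eq) es))
    still-below : ∀ e → Below (suc k) e → Below k e
    still-below e lt = [ (λ lt′ → lt′) , (λ eq → contradiction eq (¬at e)) ]′ (m<1+n⇒m<n∨m≡n lt)
  ... | yes some = record
    { n≡          = trans (cong (λ z → t + (r + z)) n≡) (sym (below-suc k))
    ; composition = c′
    ; from-vertex = λ e lt → [ (λ lt′ → Cover-weaken (λ f → f) old≤ (from-vertex e lt′))
                             , (λ eq → Cover-weaken (λ f → trans f (ρ-injective (trans eq (sym at-k)))) root≤ from-u)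
                             ]′ (m<1+n⇒m<n∨m≡n lt)
    ; size        = size + (1 + r + t * R)
    ; from-below  = Cover-weaken (λ { {q} (ns , lt) →
                        [ (λ lt′ → inj₁ (ns , lt′)) , (λ eq → inj₂ (ρ-injective (trans eq (sym at-k)))) ]′
                        (m<1+n⇒m<n∨m≡n lt) })
                      ≤-refl (Cover-⊎ from-below from-u)
    ; size≤       = begin
        size + (1 + r + t * R) + count (pendantBelow (suc k)) + 1
          ≡⟨ cong (λ z → size + (1 + r + t * R) + z + 1) (pendantBelow-suc k) ⟩
        size + (1 + r + t * R) + (r + count (pendantBelow k)) + 1
          ≡⟨ rearrange size (1 + r + t * R) r (count (pendantBelow k)) ⟩
        size + count (pendantBelow k) + 1 + (1 + r + t * R) + r
          ≤⟨ +-monoˡ-≤ r (+-monoˡ-≤ (1 + r + t * R) size≤) ⟩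
        total composition + (1 + r + t * R) + r
          ≤⟨ total≤ ⟩
        total c′ ∎
    }
    where
    open Processed done
    open ≤-Reasoning
    e : Edge
    e = proj₁ (Any.satisfied some)
    at-k : At k e
    at-k = proj₂ (Any.satisfied some)
    u : Vertex
    u = source e
    r t R : ℕ
    r = count (pendantAt k)
    t = count (otherAt k)
    R = rooted composition

    rearrange : ∀ s a r p → s + a + (r + p) + 1 ≡ s + p + 1 + a + r
    rearrange = solve-∀

    through : ∀ {e′ b} → Cover (From (target e′)) b → Cover (Through e′) b
    through {e′} = Cover-map (prepend e′)

    pendant-edges : All (λ e′ → Cover (Through e′) 1) (filter (pendantAt k) es)
    pendant-edges = All.map (λ (_ , sink , _) → through (From-sink sink)) (all-filter (pendantAt k) es)

    other-edges : All (λ e′ → Cover (Through e′) R) (filter (otherAt k) es)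
    other-edges = All.map (λ {e′} (eq , _) → through (from-target e′ eq)) (all-filter (otherAt k) es)
      where
      from-target : ∀ e′ → At k e′ → Cover (From (target e′)) R
      from-target e′ eq with nonsink⊎sink (target e′)
      ... | inj₂ sink     = Cover-weaken (λ f → f) (rooted≥1 composition) (From-sink sink)
      ... | inj₁ (e″ , p) = subst (λ v → Cover (From v) R) p (from-vertex e″
              (subst (λ v → ρ v < k) (sym p) (subst (ρ (target e′) <_) eq (ρ-decreasing e′))))

    from-u : Cover (From u) (1 + r + t * R)
    from-u = Cover-weaken first-edge (≤-reflexive (cong (λ z → 1 + z + t * R) (*-identityʳ r)))
      (Cover-⊎ (Cover-⊎ (Cover-singleton (trivial u)) (Cover-Any pendant-edges)) (Cover-Any other-edges))
      where
      first-edge : ∀ {q} → From u q → (q ≡ trivial u ⊎ Any (λ e′ → Through e′ q) (filter (pendantAt k) es)) ⊎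
                                      Any (λ e′ → Through e′ q) (filter (otherAt k) es)
      first-edge {_ , _ , ε} refl = inj₁ (inj₁ refl)
      first-edge {_ , w , (e′ , eq , refl) ◅ p} refl with Pendant? e′
      ... | yes pend = inj₁ (inj₂ (lose
              (∈-filter⁺ (pendantAt k) (∈-es e′) (trans (cong ρ eq) at-k , pend)) (through-◅ e′ eq p)))
      ... | no other = inj₂ (lose
              (∈-filter⁺ (otherAt k) (∈-es e′) (trans (cong ρ eq) at-k , other)) (through-◅ e′ eq p))

    some-edge : 1 ≤ r + t
    some-edge with Pendant? e
    ... | yes p = ≤-trans (length-filter-pos (pendantAt k) (∈-es e) (at-k , p)) (m≤m+n r t)
    ... | no ¬p = ≤-trans (length-filter-pos (otherAt k) (∈-es e) (at-k , ¬p)) (m≤n+m t r)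

    -- Excludes the exceptional case of absorb: if no vertex was treated before, then e₀ leaves u, and e₀ is
    -- not pendant.
    not-first : 1 ≤ t ⊎ 2 ≤ R
    not-first with m≤n⇒m<n∨m≡n (subst (ρ (source e₀) ≤_) at-k (e₀-minimal e))
    ... | inj₁ lt = inj₂ (rooted≥2 composition
                      (subst (1 ≤_) (sym n≡) (length-filter-pos (Below? k) (∈-es e₀) lt)))
    ... | inj₂ eq = inj₁ (length-filter-pos (otherAt k) (∈-es e₀) (eq , λ (_ , ≢s₀) → ≢s₀ refl))

    absorbed = absorb r t composition some-edge not-first
    c′ = proj₁ absorbed
    root≤ : 1 + r + t * R ≤ rooted c′
    root≤ = proj₁ (proj₂ (proj₂ absorbed))
    total≤ : total composition + (1 + r + t * R) + r ≤ total c′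
    total≤ = proj₂ (proj₂ (proj₂ absorbed))
    old≤ : R ≤ rooted c′
    old≤ = proj₁ (proj₂ absorbed)

  process : ∀ k → Processed k
  process zero    = process-zero
  process (suc k) = process-suc k (process k)

  bounded-by-composition : ∃ λ (c : Composition N) → m ≤ total c
  bounded-by-composition = subst Composition n≡N composition , subst (m ≤_) (same-total n≡N) (≤-trans m≤ size≤)
    where
    K : ℕ
    K = suc (max 0 (map (λ e → ρ (source e)) es))
    below-K : ∀ e → Below K e
    below-K e = s≤s (All.lookup (xs≤max 0 (map (λ e → ρ (source e)) es)) (∈-map⁺ _ (∈-es e)))
    open Processed (process K)
    n≡N : n ≡ N
    n≡N = trans n≡ (trans
      (cong length (filter-all (Below? K) (All.universal below-K es)))
      (length-tabulate (Inverse.from edges)))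
    same-total : ∀ {n′} (eq : n ≡ n′) → total composition ≡ total (subst Composition eq composition)
    same-total refl = refl
    -- A path that begins at a sink is trivial; the sink is either s₀ or the target of a pendant edge.
    everything : ∀ q →
      (FromNonsinkBelow K q ⊎ Any (λ e → q ≡ trivial (target e)) (filter (pendantBelow K) es)) ⊎ q ≡ trivial s₀
    everything q@(u , _ , p) with nonsink⊎sink u
    ... | inj₁ (e , eq) = inj₁ (inj₁ ((e , eq) , subst (λ v → ρ v < K) eq (below-K e)))
    ... | inj₂ sink with p | u ≟ᵛ s₀ | incoming sink
    ...   | (e , eq , _) ◅ _ | _        | _          = contradiction eq (sink e)
    ...   | ε                | yes refl | _          = inj₂ refl
    ...   | ε                | no ≢s₀   | e , refl   =
      inj₁ (inj₂ (lose (∈-filter⁺ (pendantBelow K) (∈-es e) (below-K e , sink , ≢s₀)) refl))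
    m≤ : m ≤ size + count (pendantBelow K) + 1
    m≤ = Cover⇒≤ paths (Cover-weaken (λ {q} _ → everything q)
      (≤-reflexive (cong (λ z → size + z + 1) (*-identityʳ _)))
      (Cover-⊎ (Cover-⊎ from-below (Cover-Any (All.universal (λ e → Cover-singleton (trivial (target e))) _)))
               (Cover-singleton (trivial s₀))))
-- Realisation of compositions by graphs

-- A graph with n edges and t paths, r of which begin at a vertex root from which all vertices can be
-- reached.  The height, which drops along every edge, witnesses acyclicity.
record Rooted (n r t : ℕ) : Set₁ where
  field
    graph : Graph
  open Graph graph public
  field
    root       : Vertex
    edges      : HasCardinality Edge n
    reaches    : ∀ v → Star _⟶_ root v
    height     : Vertex → ℕ
    descending : ∀ e → height (target e) < height (source e)
    rootPaths  : HasCardinality (Σ[ v ∈ Vertex ] Star _⟶_ root v) r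
    paths      : HasCardinality FP t

module _ {n r t : ℕ} (G : Rooted n r t) where

  open Rooted G

  Rooted-connected : Connected
  Rooted-connected u v =
    EqClosure.symmetric _⟶_ (Star.map fwd (reaches u)) ◅◅ Star.map fwd (reaches v)

  Rooted-acyclic : Acyclic
  Rooted-acyclic v cycle = <-irrefl refl (lower cycle)
    where
    lower : ∀ {u w} → TransClosure _⟶_ u w → height w < height u
    lower [ e , refl , refl ]       = descending e
    lower ((e , refl , refl) ∷ p)   = <-trans (lower p) (descending e)

  Rooted-pathNumber : PathNumber n t
  Rooted-pathNumber = graph , edges , Rooted-connected , Rooted-acyclic , paths

point : Rooted 0 1 1
point = record
  { graph      = record { Vertex = ⊤ ; Edge = Fin 0 ; source = λ () ; target = λ () }
  ; root       = tt
  ; edges      = ↔-refl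
  ; reaches    = λ _ → ε
  ; height     = λ _ → 0
  ; descending = λ ()
  ; rootPaths  = mk↔ₛ′ (λ _ → zero) (λ _ → tt , ε) (λ { zero → refl }) λ { (_ , ε) → refl ; (_ , (() , _) ◅ _) }
  ; paths      = mk↔ₛ′ (λ _ → zero) (λ _ → tt , tt , ε) (λ { zero → refl })
                   λ { (_ , _ , ε) → refl ; (_ , _ , (() , _) ◅ _) }
  }

-- A new vertex, nothing, with suc d parallel edges to the root.
module AddSource (d : ℕ) {n r t : ℕ} (G : Rooted n r t) where

  open Rooted G

  graph⁺ : Graph
  graph⁺ = record
    { Vertex = Maybe Vertex
    ; Edge   = Fin (suc d) ⊎ Edge
    ; source = [ (λ _ → nothing) , (λ e → just (source e)) ]′
    ; target = [ (λ _ → just root) , (λ e → just (target e)) ]′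
    }

  open Graph graph⁺ using () renaming (_⟶_ to _⟶⁺_; Vertex to Vertex⁺; FP to FP⁺)

  PathsFrom : Vertex → Set
  PathsFrom u = Σ[ v ∈ Vertex ] Star _⟶_ u v

  PathsFrom⁺ : Vertex⁺ → Set
  PathsFrom⁺ u = Σ[ v ∈ Vertex⁺ ] Star _⟶⁺_ u v

  lift : ∀ {u v} → Star _⟶_ u v → Star _⟶⁺_ (just u) (just v)
  lift = Star.gmap just λ { (e , refl , refl) → inj₂ e , refl , refl }

  -- The paths beginning at an old vertex are the same in both graphs, by up and down.
  up : ∀ {u} → PathsFrom u → PathsFrom⁺ (just u)
  up (v , p) = just v , lift p

  down : ∀ {u v} → Star _⟶⁺_ (just u) v → PathsFrom u
  down {u} ε                         = u , ε
  down ((inj₂ e , refl , refl) ◅ p) = let v , q = down p in v , (e , refl , refl) ◅ q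

  down-lift : ∀ {u v} (p : Star _⟶_ u v) → down (lift p) ≡ (v , p)
  down-lift ε                       = refl
  down-lift ((e , refl , refl) ◅ p) = cong (λ (v , q) → v , (e , refl , refl) ◅ q) (down-lift p)

  up-down : ∀ {u v} (p : Star _⟶⁺_ (just u) v) → up (down p) ≡ (v , p)
  up-down ε                            = refl
  up-down ((inj₂ e , refl , refl) ◅ p) =
    cong (λ (v , q) → v , (inj₂ e , refl , refl) ◅ q) (up-down p)

  fromNew : PathsFrom⁺ nothing ↔ (⊤ ⊎ (Fin (suc d) × PathsFrom root))
  fromNew = mk↔ₛ′ to from to-from from-to
    where
    to : PathsFrom⁺ nothing → ⊤ ⊎ (Fin (suc d) × PathsFrom root)
    to (_ , ε)                         = inj₁ tt
    to (_ , (inj₁ i , refl , refl) ◅ p) = inj₂ (i , down p)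
    from : ⊤ ⊎ (Fin (suc d) × PathsFrom root) → PathsFrom⁺ nothing
    from (inj₁ _)           = nothing , ε
    from (inj₂ (i , v , p)) = just v , (inj₁ i , refl , refl) ◅ lift p
    to-from : ∀ s → to (from s) ≡ s
    to-from (inj₁ _)           = refl
    to-from (inj₂ (i , v , p)) = cong (λ q → inj₂ (i , q)) (down-lift p)
    from-to : ∀ s → from (to s) ≡ s
    from-to (_ , ε)                          = refl
    from-to (_ , (inj₁ i , refl , refl) ◅ p) =
      cong (λ (v , q) → v , (inj₁ i , refl , refl) ◅ q) (up-down p)

  allPaths : FP⁺ ↔ (FP ⊎ PathsFrom⁺ nothing)
  allPaths = mk↔ₛ′ to from to-from from-to
    where
    to : FP⁺ → FP ⊎ PathsFrom⁺ nothing
    to (nothing , q)    = inj₂ q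
    to (just u , _ , p) = inj₁ (u , down p)
    from : FP ⊎ PathsFrom⁺ nothing → FP⁺
    from (inj₁ (u , q)) = just u , up q
    from (inj₂ q)       = nothing , q
    to-from : ∀ s → to (from s) ≡ s
    to-from (inj₁ (u , v , p)) = cong (λ q → inj₁ (u , q)) (down-lift p)
    to-from (inj₂ q)           = refl
    from-to : ∀ s → from (to s) ≡ s
    from-to (nothing , q)    = refl
    from-to (just u , _ , p) = cong (just u ,_) (up-down p)

  addSource : Rooted (suc d + n) (1 + suc d * r) (t + (1 + suc d * r))
  addSource = record
    { graph      = graph⁺
    ; root       = nothing
    ; edges      = ↔-trans (↔-refl ⊎-↔ edges) (↔-sym +↔⊎)
    ; reaches    = λ { nothing → ε ; (just v) → (inj₁ zero , refl , refl) ◅ lift (reaches v) }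
    ; height     = maybe height (suc (height root))
    ; descending = λ { (inj₁ _) → ≤-refl ; (inj₂ e) → descending e }
    ; rootPaths  = rootPaths⁺
    ; paths      = ↔-trans allPaths (↔-trans (paths ⊎-↔ rootPaths⁺) (↔-sym +↔⊎))
    }
    where
    rootPaths⁺ : HasCardinality (PathsFrom⁺ nothing) (1 + suc d * r)
    rootPaths⁺ = ↔-trans fromNew (↔-trans
      (↔-sym 1↔⊤ ⊎-↔ ↔-trans (↔-refl ×-↔ rootPaths) (↔-sym *↔×)) (↔-sym +↔⊎))

realise : ∀ {n} (c : Composition n) → Rooted n (rooted c) (total c)
realise []     = point
realise (1∷ c) = AddSource.addSource 0 (realise c)
realise (2∷ c) = AddSource.addSource 1 (realise c)
realise (3∷ c) = AddSource.addSource 2 (realise c)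

-- The optimal compositions

-- The composition c with j parts 3 prepended.
threes : ∀ j {n} → Composition n → Composition (j * 3 + n)
threes zero    c = c
threes (suc j) c = 3∷ threes j c

-- The number of paths into the last vertex of a chain of j parts 3 when x paths lead into the first one.
grown : ℕ → ℕ → ℕ
grown zero    x = x
grown (suc j) x = grown j (1 + 3 * x)

odd-grown : ∀ j x → odd (grown j x) ≡ 3 ^ j * odd x
odd-grown zero    x = sym (+-identityʳ (odd x))
odd-grown (suc j) x = trans (odd-grown j (1 + 3 * x)) (eq x (3 ^ j))
  where
  eq : ∀ x q → q * (1 + 2 * (1 + 3 * x)) ≡ 3 * q * (1 + 2 * x)
  eq = solve-∀

meeting-threes : ∀ j x y {n} (c : Composition n) →
  4 * meeting x y (threes j c) + (odd x + 2 * j) ≡ 3 ^ j * odd x + 4 * meeting (grown j x) y c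
meeting-threes zero    x y c = eq x (meeting x y c)
  where
  eq : ∀ x h → 4 * h + (1 + 2 * x + 2 * 0) ≡ 1 * (1 + 2 * x) + 4 * h
  eq = solve-∀
meeting-threes (suc j) x y c = begin
  4 * (x + h) + (odd x + 2 * suc j)                            ≡⟨ eq₁ x h j ⟩
  4 * h + (odd (1 + 3 * x) + 2 * j)                            ≡⟨ meeting-threes j (1 + 3 * x) y c ⟩
  3 ^ j * odd (1 + 3 * x) + 4 * meeting (grown (suc j) x) y c  ≡⟨ eq₂ x (3 ^ j) (meeting (grown (suc j) x) y c) ⟩
  3 ^ suc j * odd x + 4 * meeting (grown (suc j) x) y c        ∎
  where
  open ≡-Reasoning
  h : ℕ
  h = meeting (1 + 3 * x) y (threes j c)
  eq₁ : ∀ x h j → 4 * (x + h) + (1 + 2 * x + 2 * (1 + j)) ≡ 4 * h + (1 + 2 * (1 + 3 * x) + 2 * j)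
  eq₁ = solve-∀
  eq₂ : ∀ x q g → q * (1 + 2 * (1 + 3 * x)) + 4 * g ≡ 3 * q * (1 + 2 * x) + 4 * g
  eq₂ = solve-∀

meeting-threes-21 : ∀ j x →
  4 * meeting x 1 (threes j (2∷ 1∷ [])) + (odd x + 2 * j) ≡ 11 * (3 ^ j * odd x) + 2
meeting-threes-21 j x = trans (meeting-threes j x 1 (2∷ 1∷ []))
  (trans (eq (grown j x) (3 ^ j * odd x)) (trans (cong (λ z → 3 ^ j * odd x + (10 * z + 2))
    (odd-grown j x)) (eq′ (3 ^ j * odd x))))
  where
  eq : ∀ z w → w + 4 * (z + (1 + 2 * z + (1 + 1 * (1 + 2 * z)) * 1)) ≡ w + (10 * (1 + 2 * z) + 2)
  eq = solve-∀
  eq′ : ∀ w → w + (10 * w + 2) ≡ 11 * w + 2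
  eq′ = solve-∀

meeting-threes-221 : ∀ j x →
  4 * meeting x 1 (threes j (2∷ 2∷ 1∷ [])) + (odd x + 2 * j) ≡ 23 * (3 ^ j * odd x) + 10
meeting-threes-221 j x = trans (meeting-threes j x 1 (2∷ 2∷ 1∷ []))
  (trans (eq (grown j x) (3 ^ j * odd x)) (trans (cong (λ z → 3 ^ j * odd x + (22 * z + 10))
    (odd-grown j x)) (eq′ (3 ^ j * odd x))))
  where
  eq : ∀ z w → w + 4 * (z + (1 + 2 * z + (1 + 2 * (1 + 2 * z) + (1 + 1 * (1 + 2 * (1 + 2 * z))) * 1))) ≡
               w + (22 * (1 + 2 * z) + 10)
  eq = solve-∀
  eq′ : ∀ w → w + (22 * w + 10) ≡ 23 * w + 10
  eq′ = solve-∀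

-- The compositions 1,2,3,...,3,2,1 and 1,2,2,3,...,3,2,2,1 and 1,2,3,...,3,2,2,1 with j parts 3.
optimal₀ : ∀ j → Composition (3 + (j * 3 + 3))
optimal₀ j = 1∷ 2∷ threes j (2∷ 1∷ [])

optimal₁ : ∀ j → Composition (5 + (j * 3 + 5))
optimal₁ j = 1∷ 2∷ 2∷ threes j (2∷ 2∷ 1∷ [])

optimal₂ : ∀ j → Composition (3 + (j * 3 + 5))
optimal₂ j = 1∷ 2∷ threes j (2∷ 2∷ 1∷ [])

total-optimal₀ : ∀ j → 4 * total (optimal₀ j) + 2 * j ≡ 121 * 3 ^ j + 3
total-optimal₀ j = trans (cong (λ z → 4 * z + 2 * j) (total≡meeting (optimal₀ j)))
  (+-cancelʳ-≡ 11 _ _ (trans (eq h j) (trans (cong (_+ 12) (meeting-threes-21 j 5)) (eq′ (3 ^ j)))))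
  where
  h : ℕ
  h = meeting 5 1 (threes j (2∷ 1∷ []))
  eq : ∀ h j → 4 * (1 + (2 + h)) + 2 * j + 11 ≡ 4 * h + (11 + 2 * j) + 12
  eq = solve-∀
  eq′ : ∀ q → 11 * (q * 11) + 2 + 12 ≡ 121 * q + 3 + 11
  eq′ = solve-∀

total-optimal₁ : ∀ j → 4 * total (optimal₁ j) + 2 * j ≡ 529 * 3 ^ j + 19
total-optimal₁ j = trans (cong (λ z → 4 * z + 2 * j) (total≡meeting (optimal₁ j)))
  (+-cancelʳ-≡ 23 _ _ (trans (eq h j) (trans (cong (_+ 32) (meeting-threes-221 j 11)) (eq′ (3 ^ j)))))
  where
  h : ℕ
  h = meeting 11 1 (threes j (2∷ 2∷ 1∷ []))
  eq : ∀ h j → 4 * (1 + (2 + (5 + h))) + 2 * j + 23 ≡ 4 * h + (23 + 2 * j) + 32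
  eq = solve-∀
  eq′ : ∀ q → 23 * (q * 23) + 10 + 32 ≡ 529 * q + 19 + 23
  eq′ = solve-∀

total-optimal₂ : ∀ j → 4 * total (optimal₂ j) + 2 * j ≡ 253 * 3 ^ j + 11
total-optimal₂ j = trans (cong (λ z → 4 * z + 2 * j) (total≡meeting (optimal₂ j)))
  (+-cancelʳ-≡ 11 _ _ (trans (eq h j) (trans (cong (_+ 12) (meeting-threes-221 j 5)) (eq′ (3 ^ j)))))
  where
  h : ℕ
  h = meeting 5 1 (threes j (2∷ 2∷ 1∷ []))
  eq : ∀ h j → 4 * (1 + (2 + h)) + 2 * j + 11 ≡ 4 * h + (11 + 2 * j) + 12
  eq = solve-∀
  eq′ : ∀ q → 23 * (q * 11) + 10 + 12 ≡ 253 * q + 11 + 11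
  eq′ = solve-∀

-- A bound for all compositions that is attained by c makes the number of paths of c maximal.
isMaximum : ∀ {n} (c : Composition (suc n)) a b → 12 * total c + a ≡ b →
  (∀ (c′ : Composition (suc n)) → 12 * total c′ + a ≤ b) → IsMaximum (PathNumber (suc n)) (total c)
isMaximum c a b attained bounded = Rooted-pathNumber (realise c) , upper
  where
  upper : ∀ m → PathNumber _ m → m ≤ total c
  upper m (E , edges , connected , _ , paths) =
    let c′ , m≤ = Reduction.bounded-by-composition E edges connected paths (Inverse.from edges zero)
    in ≤-trans m≤ (*-cancelˡ-≤ 12 (+-cancelʳ-≤ a _ _ (≤-trans (bounded c′) (≤-reflexive (sym attained)))))

-- The closed formula

open import Data.Integer as ℤ using (+_)
import Data.Integer.Properties as ℤ
open import Data.Rational as ℚ using (_/_)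
open import Data.Rational.Properties using (fromℚᵘ-cong)
open import Data.Rational.Unnormalised using (mkℚᵘ)
open import Data.Rational.Unnormalised.Properties using (*-cancelˡ-/)

quarter : ∀ a b c p → 4 * p + b ≡ a + c → + p ℚ./ 1 ≡ (+ a ℤ.- + b ℤ.+ + c) ℚ./ 4
quarter a b c p eq = trans
  (sym (fromℚᵘ-cong {mkℚᵘ (+ 4 ℤ.* + p) 3} {mkℚᵘ (+ p) 0} (*-cancelˡ-/ 4 {+ p} {1}))) (cong (ℚ._/ 4) (begin
  + 4 ℤ.* + p                          ≡⟨ ℤ.pos-* 4 p ⟨
  + (4 * p)                            ≡⟨ ℤ.+-identityʳ _ ⟨
  + (4 * p) ℤ.+ + 0                    ≡⟨ cong (λ z → + (4 * p) ℤ.+ z) (ℤ.+-inverseʳ (+ b)) ⟨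
  + (4 * p) ℤ.+ (+ b ℤ.- + b)          ≡⟨ ℤ.+-assoc (+ (4 * p)) (+ b) (ℤ.- (+ b)) ⟨
  + (4 * p + b) ℤ.- + b                ≡⟨ cong (λ z → + z ℤ.- + b) eq ⟩
  + a ℤ.+ + c ℤ.- + b                  ≡⟨ ℤ.+-assoc (+ a) (+ c) (ℤ.- (+ b)) ⟩
  + a ℤ.+ (+ c ℤ.- + b)                ≡⟨ cong (λ z → + a ℤ.+ z) (ℤ.+-comm (+ c) (ℤ.- (+ b))) ⟩
  + a ℤ.+ (ℤ.- (+ b) ℤ.+ + c)          ≡⟨ ℤ.+-assoc (+ a) (ℤ.- (+ b)) (+ c) ⟨
  + a ℤ.- + b ℤ.+ + c                  ∎))
  where open ≡-Reasoning

theorem3p15 : ∀ (N : ℕ) → 16 ≤ N →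
    ∀ (k : ℕ) (i : Fin 3) → N ≡ 3 * k + toℕ i →
    ∃[ P ] (IsMaximum (PathNumber N) P × + P / 1 ≡ maxPathsFormula k i)
-- In each case N ≥ 16 gives k = 6 + t or k = 5 + t.
theorem3p15 N 16≤N k zero N≡
  with m≤n⇒∃[o]m+o≡n (*-cancelˡ-< 3 5 k (subst (16 ≤_) (trans N≡ (+-identityʳ (3 * k))) 16≤N))
... | t , refl = total c ,
    subst (λ n → IsMaximum (PathNumber n) (total c)) (trans (size t) (sym N≡))
      (isMaximum c (6 * t + 15) (29403 * 3 ^ t + 0)
        (+-cancelʳ-≡ 9 _ _ (trans (l t (total c)) (trans (cong (3 *_) attained) (r (3 ^ t)))))
        (total≤₀ t (size′ t))) ,
    quarter (121 * 3 ^ (4 + t)) (2 * (6 + t)) 7 (total c)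
      (trans (l′ t (total c)) (trans (cong (_+ 4) attained) (+-assoc (121 * 3 ^ (4 + t)) 3 4)))
  where
  c = optimal₀ (4 + t)
  attained = total-optimal₀ (4 + t)
  size : ∀ t → 3 + ((4 + t) * 3 + 3) ≡ 3 * (6 + t) + 0
  size = solve-∀
  size′ : ∀ t → 3 + ((4 + t) * 3 + 3) ≡ 18 + t * 3
  size′ = solve-∀
  l : ∀ t p → 12 * p + (6 * t + 15) + 9 ≡ 3 * (4 * p + 2 * (4 + t))
  l = solve-∀
  r : ∀ q → 3 * (121 * (3 * (3 * (3 * (3 * q)))) + 3) ≡ 29403 * q + 0 + 9
  r = solve-∀
  l′ : ∀ t p → 4 * p + 2 * (6 + t) ≡ 4 * p + 2 * (4 + t) + 4
  l′ = solve-∀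
theorem3p15 N 16≤N k (suc zero) N≡
  with m≤n⇒∃[o]m+o≡n (*-cancelˡ-≤ {5} {k} 3 (+-cancelʳ-≤ 1 15 (3 * k) (subst (16 ≤_) N≡ 16≤N)))
... | t , refl = total c ,
    subst (λ n → IsMaximum (PathNumber n) (total c)) (trans (size t) (sym N≡))
      (isMaximum c (6 * t + 15) (14283 * 3 ^ t + 60)
        (trans (l t (total c)) (trans (cong (λ z → 3 * z + 3) attained) (r (3 ^ t))))
        (total≤₁ t (size′ t))) ,
    quarter (529 * 3 ^ (2 + t)) (2 * (5 + t)) 25 (total c)
      (trans (l′ t (total c)) (trans (cong (_+ 6) attained) (+-assoc (529 * 3 ^ (2 + t)) 19 6)))
  where
  c = optimal₁ (2 + t)
  attained = total-optimal₁ (2 + t)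
  size : ∀ t → 5 + ((2 + t) * 3 + 5) ≡ 3 * (5 + t) + 1
  size = solve-∀
  size′ : ∀ t → 5 + ((2 + t) * 3 + 5) ≡ 16 + t * 3
  size′ = solve-∀
  l : ∀ t p → 12 * p + (6 * t + 15) ≡ 3 * (4 * p + 2 * (2 + t)) + 3
  l = solve-∀
  r : ∀ q → 3 * (529 * (3 * (3 * q)) + 19) + 3 ≡ 14283 * q + 60
  r = solve-∀
  l′ : ∀ t p → 4 * p + 2 * (5 + t) ≡ 4 * p + 2 * (2 + t) + 6
  l′ = solve-∀
theorem3p15 N 16≤N k (suc (suc zero)) N≡
  with m≤n⇒∃[o]m+o≡n (*-cancelˡ-< 3 4 k (<⇒≤ (+-cancelʳ-≤ 2 14 (3 * k) (subst (16 ≤_) N≡ 16≤N))))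
... | t , refl = total c ,
    subst (λ n → IsMaximum (PathNumber n) (total c)) (trans (size t) (sym N≡))
      (isMaximum c (6 * t + 15) (20493 * 3 ^ t + 30)
        (+-cancelʳ-≡ 3 _ _ (trans (l t (total c)) (trans (cong (3 *_) attained) (r (3 ^ t)))))
        (total≤₂ t (size′ t))) ,
    quarter (253 * 3 ^ (3 + t)) (2 * (5 + t)) 15 (total c)
      (trans (l′ t (total c)) (trans (cong (_+ 4) attained) (+-assoc (253 * 3 ^ (3 + t)) 11 4)))
  where
  c = optimal₂ (3 + t)
  attained = total-optimal₂ (3 + t)
  size : ∀ t → 3 + ((3 + t) * 3 + 5) ≡ 3 * (5 + t) + 2
  size = solve-∀
  size′ : ∀ t → 3 + ((3 + t) * 3 + 5) ≡ 17 + t * 3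
  size′ = solve-∀
  l : ∀ t p → 12 * p + (6 * t + 15) + 3 ≡ 3 * (4 * p + 2 * (3 + t))
  l = solve-∀
  r : ∀ q → 3 * (253 * (3 * (3 * (3 * q))) + 11) ≡ 20493 * q + 30 + 3
  r = solve-∀
  l′ : ∀ t p → 4 * p + 2 * (5 + t) ≡ 4 * p + 2 * (3 + t) + 4
  l′ = solve-∀
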